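{- Let $\Phi$ be the property of being orderable. Then for all integers $n\ge3$, $$\tau_\Phi(n,0)=n-2.$$ Further, up to isomorphism, the nonlinear orderable betweenness structures of minimum co-size (that is, those orderable betweenness structures of order $n\geq 3$ whose co-size equals $\tau_\Phi(n,0)$) are the following: - $\mathcal{Q}_n^2$ for $n\ge3$; - $\mathcal{R}_{n,i}^2$ for $n\ge4$, $i\in I_n^2$; - $\mathcal{S}_n^2$ for $n\ge3$.
   Context: A betweenness structure is a pair $\mathcal{B}=(X,\beta)$ where $X$ is a nonempty finite set and $\beta\subseteq X^3$; write $(x\ y\ z)$ for $(x,y,z)\in\beta$. All betweenness structures are assumed to be almost-metrizable, i.e. for all $x,y,z,w\in X$: (P1) $(x\ x\ z)$; (P2) $(x\ y\ z)\Rightarrow(z\ y\ x)$; (P3) $(x\ y\ z)\wedge(y\ x\ z)\Rightarrow x=y$; (P4) $(x\ y\ z)\wedge(x\ w\ y)\Rightarrow(x\ w\ z)\wedge(w\ y\ z)$. The order of $\mathcal{B}$ is $|X|$. A set of three distinct points is collinear if some ordering of it is in $\beta$; otherwise it is a triangle. The co-size of $\mathcal{B}$ is its number of triangles; $\mathcal{B}$ is linear if its co-size is $0$, and nonlinear otherwise. Isomorphisms are bijections of ground sets preserving betweenness in both directions. Graphs are connected with positive real edge weights (weight $1$ unless specified). For a graph $W$ with shortest-path metric $d_W$ (path length is the sum of edge weights), the betweenness structure $\mathcal{B}(W)$ induced by $W$ lives on the vertex set and has $(x\ y\ z)$ iff $d_W(x,z)=d_W(x,y)+d_W(y,z)$.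 A betweenness structure is ordered if it is induced by a path. A structure $(X,\beta_1)$ is an extension of $(X,\beta_2)$ (same ground set) if $\beta_1\supseteq\beta_2$. A betweenness structure is orderable if it has an ordered extension. For a hereditary property $\Phi$ of betweenness structures, $B_\Phi(n,m)$ is the set of betweenness structures of order $n$ and co-size $m$ that satisfy $\Phi$, and $\tau_\Phi(n,k)=\min\{m>k:B_\Phi(n,m)\ne\emptyset\}$. Let $I_n^2=\{i\in\mathbb{N}:1\le i\le\lceil\frac{n-3}{2}\rceil\}$. The following graphs have vertex set $\{x_1,\dots,x_{n-2},y,z\}$ and are obtained from the path $P=x_1x_2\ldots x_{n-2}$: - $Q_n^2$ ($n\ge3$): add edges $\{y,x_1\},\{z,x_1\}$ and $\{y,z\}$; - $R_{n,i}^2$ ($n\ge4$, $i\in I_n^2$): delete edge $\{x_i,x_{i+1}\}$, and add edges $\{y,x_i\},\{z,x_i\},\{y,x_{i+1}\},\{z,x_{i+1}\}$ and $\{y,z\}$; - $S_n^2$ ($n\ge3$): add edges $\{x_1,y\},\{x_{n-2},z\}$, and add edge $\{y,z\}$ of weight $n-2$. $\mathcal{Q}_n^2,\mathcal{R}_{n,i}^2,\mathcal{S}_n^2$ are the betweenness structures induced by $Q_n^2,R_{n,i}^2,S_n^2$. -}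

module Defs where

open import Data.Bool using (Bool; true; false; if_then_else_; _∧_; _∨_; not; T)
open import Data.Empty using (⊥-elim)
open import Data.Fin using (Fin; zero; suc; toℕ; fromℕ<)
import Data.Fin as Fin
import Data.Fin.Properties as Finₚ
open import Data.List using (List; []; _∷_; length; filter; allFin; cartesianProduct)
open import Data.List.Membership.Propositional using (_∈_)
open import Data.List.Relation.Unary.All.Properties using (¬Any⇒All¬)
open import Data.List.Relation.Unary.AllPairs using ([]; _∷_)
open import Data.List.Relation.Unary.All using ([])
open import Data.List.Relation.Unary.Any using (here; there)
open import Data.List.Relation.Unary.Unique.Propositional using (Unique)
open import Data.Nat
open import Data.Nat.Properties
open import Data.Product using (∃; Σ-syntax; _×_; _,_; proj₁; proj₂)
open import Data.Sum using (_⊎_; inj₁; inj₂)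
open import Function using (_∘_)
open import Function.Bundles using (_↔_; _⇔_; Inverse; mk↔ₛ′)
open import Function.Properties.Inverse using (Inverse⇒Injection)
open import Relation.Binary using (DecidableEquality)
open import Relation.Binary.PropositionalEquality
open import Relation.Nullary
open import Relation.Nullary.Decidable using (map′; _×-dec_; _⊎-dec_; via-injection)

open Inverse using (to; from; strictlyInverseʳ)

record FiniteSet : Set₁ where
  field
    Carrier     : Set
    size        : ℕ
    nonempty    : NonZero size
    enumeration : Carrier ↔ Fin size

  point : Fin size → Carrier
  point = from enumeration

  infix 4 _≟ᵥ_
  _≟ᵥ_ : DecidableEquality Carrier
  _≟ᵥ_ = via-injection (Inverse⇒Injection enumeration) Fin._≟_

  any? : {P : Carrier → Set} → (∀ x → Dec (P x)) → Dec (∃ P)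
  any? {P} P? = map′
    (λ { (i , p) → point i , p })
    (λ { (x , p) → to enumeration x
                 , subst P (sym (strictlyInverseʳ enumeration x)) p })
    (Finₚ.any? (P? ∘ point))

open FiniteSet using (Carrier; size)

-- β is required to be decidable so that the number of triangles is a
-- well-defined natural number.
record BetweennessStructure (V : FiniteSet) : Set₁ where
  field
    β  : Carrier V → Carrier V → Carrier V → Set
    β? : ∀ x y z → Dec (β x y z)
    P1 : ∀ x z → β x x z
    P2 : ∀ x y z → β x y z → β z y x
    P3 : ∀ x y z → β x y z → β y x z → x ≡ y
    P4 : ∀ x y z w → β x y z → β x w y → β x w z × β w y z

  Collinear : Carrier V → Carrier V → Carrier V → Set
  Collinear x y z =
    β x y z ⊎ β x z y ⊎ β y x z ⊎ β y z x ⊎ β z x y ⊎ β z y x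

  collinear? : ∀ x y z → Dec (Collinear x y z)
  collinear? x y z =
    β? x y z ⊎-dec β? x z y ⊎-dec β? y x z ⊎-dec
    β? y z x ⊎-dec β? z x y ⊎-dec β? z y x

  -- Every three-element subset occurs exactly once as an increasing triple
  -- of indices.
  IsTriangle : Fin (size V) × Fin (size V) × Fin (size V) → Set
  IsTriangle (i , j , k) =
    i Fin.< j × j Fin.< k ×
    ¬ Collinear (FiniteSet.point V i) (FiniteSet.point V j) (FiniteSet.point V k)

  isTriangle? : ∀ t → Dec (IsTriangle t)
  isTriangle? (i , j , k) =
    i Fin.<? j ×-dec j Fin.<? k ×-dec ¬? (collinear? _ _ _)

  triangles : List (Fin (size V) × Fin (size V) × Fin (size V))
  triangles = filter isTriangle?
    (cartesianProduct (allFin _) (cartesianProduct (allFin _) (allFin _)))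

  coSize : ℕ
  coSize = length triangles

open BetweennessStructure using (coSize)

infix 4 _≅_
record _≅_ {V W : FiniteSet}
           (B : BetweennessStructure V) (C : BetweennessStructure W) : Set where
  private
    module B = BetweennessStructure B
    module C = BetweennessStructure C
  field
    bijection : Carrier V ↔ Carrier W
    preserves : ∀ x y z →
      B.β x y z ⇔ C.β (to bijection x) (to bijection y) (to bijection z)

_IsExtensionOf_ : {V : FiniteSet} → (B₁ B₂ : BetweennessStructure V) → Set
B₁ IsExtensionOf B₂ = ∀ x y z →
  BetweennessStructure.β B₂ x y z → BetweennessStructure.β B₁ x y z

-- A weight function describes a graph: u and v are adjacent when w u v is
-- positive, and w u v is then the weight of the edge.
module Walks {V : Set} (w : V → V → ℕ) where

  Adjacent : V → V → Set
  Adjacent u v = 0 < w u v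

  data Walk : V → V → Set where
    nil  : ∀ {u} → Walk u u
    step : ∀ {u v t} → Adjacent u v → Walk v t → Walk u t

  vertices : ∀ {u v} → Walk u v → List V
  vertices {u} nil        = u ∷ []
  vertices {u} (step _ p) = u ∷ vertices p

  len : ∀ {u v} → Walk u v → ℕ
  len nil                = 0
  len (step {u} {v} _ p) = w u v + len p

  record Path (u v : V) : Set where
    constructor path
    field
      walk     : Walk u v
      distinct : Unique (vertices walk)

  pathLength : ∀ {u v} → Path u v → ℕ
  pathLength p = len (Path.walk p)

  _++ʷ_ : ∀ {u v t} → Walk u v → Walk v t → Walk u t
  nil      ++ʷ q = q
  step e p ++ʷ q = step e (p ++ʷ q)

  len-++ : ∀ {u v t} (p : Walk u v) (q : Walk v t) →
           len (p ++ʷ q) ≡ len p + len q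
  len-++ nil                q = refl
  len-++ (step {u} {v} e p) q =
    trans (cong (w u v +_) (len-++ p q)) (sym (+-assoc (w u v) (len p) (len q)))

  module _ (w-sym : ∀ u v → w u v ≡ w v u) where

    adjacent-sym : ∀ {u v} → Adjacent u v → Adjacent v u
    adjacent-sym {u} {v} = subst (0 <_) (w-sym u v)

    reverse : ∀ {u v} → Walk u v → Walk v u
    reverse nil        = nil
    reverse (step e p) = reverse p ++ʷ step (adjacent-sym e) nil

    len-reverse : ∀ {u v} (p : Walk u v) → len (reverse p) ≡ len p
    len-reverse nil                = refl
    len-reverse (step {u} {v} e p) = begin
      len (reverse p ++ʷ step (adjacent-sym e) nil)
        ≡⟨ len-++ (reverse p) _ ⟩
      len (reverse p) + (w v u + 0)
        ≡⟨ cong₂ _+_ (len-reverse p) (trans (+-identityʳ _) (w-sym v u)) ⟩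
      len p + w u v
        ≡⟨ +-comm (len p) (w u v) ⟩
      w u v + len p ∎
      where open ≡-Reasoning

    connectedVia : ∀ r → (∀ u → Walk u r) → ∀ u v → Walk u v
    connectedVia r p u v = p u ++ʷ reverse (p v)

  private
    suffix : ∀ {u v t} (p : Walk v t) → u ∈ vertices p →
             Σ[ q ∈ Walk u t ] (len q ≤ len p ×
                                (Unique (vertices p) → Unique (vertices q)))
    suffix nil        (here refl) = nil , ≤-refl , λ d → d
    suffix (step e p) (here refl) = step e p , ≤-refl , λ d → d
    suffix (step e p) (there u∈p) with suffix p u∈p
    ... | q , q≤p , keep =
      q , ≤-trans q≤p (m≤n+m _ _) , λ { (_ ∷ d) → keep d }

  module _ (_≟ᵥ_ : DecidableEquality V) where

    open import Data.List.Membership.DecPropositional _≟ᵥ_ using (_∈?_)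

    shorten : ∀ {u v} (p : Walk u v) → Σ[ q ∈ Path u v ] pathLength q ≤ len p
    shorten nil = path nil ([] ∷ []) , ≤-refl
    shorten (step {u} e p) with shorten p
    ... | path q d , q≤p with u ∈? vertices q
    ...   | no u∉q  = path (step e q) (¬Any⇒All¬ _ u∉q ∷ d) , +-monoʳ-≤ _ q≤p
    ...   | yes u∈q with suffix q u∈q
    ...     | r , r≤q , keep =
      path r (keep d) , ≤-trans r≤q (≤-trans q≤p (m≤n+m _ _))

-- Weights are positive integers rather than positive reals, which suffices for
-- paths and for the graphs Q, R and S.
record Graph (V : FiniteSet) : Set where
  field
    w         : Carrier V → Carrier V → ℕ
    w-sym     : ∀ u v → w u v ≡ w v u
    loopless  : ∀ u → w u u ≡ 0
    connected : ∀ u v → Walks.Walk w u v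

  open Walks w public
  open FiniteSet V using (_≟ᵥ_; any?)

  private
    within? : ∀ f b → b ≤ f → ∀ u v → Dec (Σ[ p ∈ Walk u v ] len p ≤ b)
    within? f b b≤f u v with u ≟ᵥ v
    ... | yes refl = yes (nil , z≤n)
    within? zero .zero z≤n u v | no u≢v = no λ where
      (nil      , _) → u≢v refl
      (step e p , l) → <⇒≱ e (≤-trans (m≤m+n _ _) l)
    within? (suc f) b b≤f u v | no u≢v = map′
      (λ { (t , (e , l) , p , m) →
           step e p , subst (_ ≤_) (m+[n∸m]≡n l) (+-monoʳ-≤ (w u t) m) })
      (λ { (nil , _) → ⊥-elim (u≢v refl)
         ; (step {v = t} e p , l) →
             t , (e , ≤-trans (m≤m+n _ _) l) , p
               , subst (_≤ _) (m+n∸m≡n (w u t) (len p)) (∸-monoˡ-≤ (w u t) l) })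
      (any? next?)
      where
      next? : ∀ t → Dec ((0 < w u t × w u t ≤ b)
                         × Σ[ p ∈ Walk t v ] len p ≤ b ∸ w u t)
      next? t with 0 <? w u t | w u t ≤? b
      ... | no ¬e  | _      = no (¬e ∘ proj₁ ∘ proj₁)
      ... | yes _  | no ¬l  = no (¬l ∘ proj₂ ∘ proj₁)
      ... | yes e  | yes l  = map′ ((e , l) ,_) proj₂ (within? f (b ∸ w u t) fuel t v)
        where
        fuel : b ∸ w u t ≤ f
        fuel = ∸-mono b≤f e

    shortestWalk : ∀ {u v} b (p : Walk u v) → len p ≤ b →
                   Σ[ p ∈ Walk u v ] (∀ (q : Walk u v) → len p ≤ len q)
    shortestWalk zero    p l = p , λ q → ≤-trans l z≤n
    shortestWalk (suc b) p l with within? b b ≤-refl _ _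
    ... | yes (p′ , l′) = shortestWalk b p′ l′
    ... | no  none      = p , λ q → ≤-trans l (≰⇒> (none ∘ (q ,_)))

  opaque
    shortestPath : ∀ u v →
      Σ[ p ∈ Path u v ] (∀ (q : Path u v) → pathLength p ≤ pathLength q)
    shortestPath u v with shortestWalk _ (connected u v) ≤-refl
    ... | p , least with shorten _≟ᵥ_ p
    ...   | q , q≤p = q , λ r → ≤-trans q≤p (least (Path.walk r))

  d : Carrier V → Carrier V → ℕ
  d u v = pathLength (proj₁ (shortestPath u v))

  d≤len : ∀ {u v} (p : Walk u v) → d u v ≤ len p
  d≤len {u} {v} p with shorten _≟ᵥ_ p
  ... | q , q≤p = ≤-trans (proj₂ (shortestPath u v) q) q≤p

  d-walk : ∀ u v → Σ[ p ∈ Walk u v ] len p ≡ d u v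
  d-walk u v = Path.walk (proj₁ (shortestPath u v)) , refl

  d-refl : ∀ u → d u u ≡ 0
  d-refl u = n≤0⇒n≡0 (d≤len nil)

  d-zero : ∀ {u v} → d u v ≡ 0 → u ≡ v
  d-zero {u} {v} eq with d-walk u v
  ... | nil      , _ = refl
  ... | step e p , l = ⊥-elim (<⇒≱ e (≤-trans (m≤m+n _ _) (≤-reflexive (trans l eq))))

  d-sym : ∀ u v → d u v ≡ d v u
  d-sym u v = ≤-antisym (half u v) (half v u)
    where
    half : ∀ u v → d u v ≤ d v u
    half u v with d-walk v u
    ... | p , eq = subst (d u v ≤_) (trans (len-reverse w-sym p) eq)
                         (d≤len (reverse w-sym p))

  d-triangle : ∀ u v t → d u t ≤ d u v + d v t
  d-triangle u v t with d-walk u v | d-walk v t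
  ... | p , eq | q , eq′ =
    subst (d u t ≤_) (trans (len-++ p q) (cong₂ _+_ eq eq′)) (d≤len (p ++ʷ q))

induced : {V : FiniteSet} → Graph V → BetweennessStructure V
induced {V} G = record
  { β  = λ x y z → d x z ≡ d x y + d y z
  ; β? = λ x y z → d x z ≟ d x y + d y z
  ; P1 = λ x z → cong (_+ d x z) (sym (d-refl x))
  ; P2 = λ x y z eq → begin-equality
      d z x          ≡⟨ d-sym z x ⟩
      d x z          ≡⟨ eq ⟩
      d x y + d y z  ≡⟨ +-comm (d x y) (d y z) ⟩
      d y z + d x y  ≡⟨ cong₂ _+_ (d-sym y z) (d-sym x y) ⟩
      d z y + d y x  ∎
  ; P3 = λ x y z eq eq′ → d-zero (n≤0⇒n≡0 (+-cancelʳ-≤ (d y z) (d x y) 0 (begin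
      d x y + d y z  ≡⟨ eq ⟨
      d x z          ≤⟨ m≤n+m (d x z) (d y x) ⟩
      d y x + d x z  ≡⟨ eq′ ⟨
      d y z          ∎)))
  ; P4 = λ x y z w xyz xwy →
      let
        split : d x w + (d w y + d y z) ≡ d x z
        split = begin-equality
          d x w + (d w y + d y z)  ≡⟨ +-assoc (d x w) (d w y) (d y z) ⟨
          d x w + d w y + d y z    ≡⟨ cong (_+ d y z) xwy ⟨
          d x y + d y z            ≡⟨ xyz ⟨
          d x z                    ∎
        wyz : d w z ≡ d w y + d y z
        wyz = ≤-antisym (d-triangle w y z) (+-cancelˡ-≤ (d x w) _ _ (begin
          d x w + (d w y + d y z)  ≡⟨ split ⟩
          d x z                    ≤⟨ d-triangle x w z ⟩
          d x w + d w z            ∎))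
      in trans (sym split) (cong (d x w +_) (sym wyz)) , wyz
  }
  where
  open Graph G using (d; d-refl; d-zero; d-sym; d-triangle)
  open ≤-Reasoning

_IsInducedBy_ : {V : FiniteSet} → BetweennessStructure V → Graph V → Set
B IsInducedBy G = ∀ x y z →
  BetweennessStructure.β B x y z ⇔ BetweennessStructure.β (induced G) x y z

IsPath : {V : FiniteSet} → Graph V → Set
IsPath {V} G = Σ[ σ ∈ (Fin (size V) ↔ Carrier V) ]
  (∀ i j → Graph.Adjacent G (to σ i) (to σ j) ⇔ ∣ toℕ i - toℕ j ∣ ≡ 1)

Ordered : {V : FiniteSet} → BetweennessStructure V → Set
Ordered {V} B = Σ[ G ∈ Graph V ] (IsPath G × B IsInducedBy G)

Orderable : {V : FiniteSet} → BetweennessStructure V → Set₁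
Orderable {V} B = Σ[ B′ ∈ BetweennessStructure V ] (B′ IsExtensionOf B × Ordered B′)

Property : Set₂
Property = ∀ {V} → BetweennessStructure V → Set₁

-- "B_Φ(n,m) is nonempty"
Realizable : Property → ℕ → ℕ → Set₁
Realizable Φ n m = Σ[ V ∈ FiniteSet ] Σ[ B ∈ BetweennessStructure V ]
  (size V ≡ n × coSize B ≡ m × Φ B)

-- "τ_Φ(n,k) is defined and equal to m"
Isτ : Property → (n k m : ℕ) → Set₁
Isτ Φ n k m = (k < m × Realizable Φ n m)
            × (∀ m′ → k < m′ → Realizable Φ n m′ → m ≤ m′)

data Vertex (n : ℕ) : Set where
  vx   : Fin (n ∸ 2) → Vertex n
  vy vz : Vertex n

vertexSet : ℕ → FiniteSet
vertexSet n = record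
  { Carrier     = Vertex n
  ; size        = 2 + (n ∸ 2)
  ; nonempty    = _
  ; enumeration = mk↔ₛ′
      (λ { vy → zero ; vz → suc zero ; (vx i) → suc (suc i) })
      (λ { zero → vy ; (suc zero) → vz ; (suc (suc i)) → vx i })
      (λ { zero → refl ; (suc zero) → refl ; (suc (suc i)) → refl })
      (λ { vy → refl ; vz → refl ; (vx i) → refl })
  }

-- The paths are numbered from 1: vx i stands for x_(index i).
index : ∀ {m} → Fin m → ℕ
index i = suc (toℕ i)

𝟙 : Bool → ℕ
𝟙 b = if b then 1 else 0

consecutive : ℕ → ℕ → Bool
consecutive a b = ∣ a - b ∣ ≡ᵇ 1

-- The symmetric weight function with w x_a x_b = xx a b, w x_a y = xy a,
-- w x_a z = xz a and w y z = yz.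
weights : ∀ {n} (xx : ℕ → ℕ → ℕ) (xy xz : ℕ → ℕ) (yz : ℕ) →
          Vertex n → Vertex n → ℕ
weights xx xy xz yz (vx i) (vx j) = xx (index i) (index j)
weights xx xy xz yz (vx i) vy     = xy (index i)
weights xx xy xz yz (vx i) vz     = xz (index i)
weights xx xy xz yz vy     (vx i) = xy (index i)
weights xx xy xz yz vz     (vx i) = xz (index i)
weights xx xy xz yz vy     vz     = yz
weights xx xy xz yz vz     vy     = yz
weights xx xy xz yz vy     vy     = 0
weights xx xy xz yz vz     vz     = 0

weights-sym : ∀ {n} xx xy xz yz → (∀ a b → xx a b ≡ xx b a) →
              ∀ (u v : Vertex n) → weights xx xy xz yz u v ≡ weights xx xy xz yz v u
weights-sym xx xy xz yz s (vx i) (vx j) = s (index i) (index j)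
weights-sym xx xy xz yz s (vx i) vy     = refl
weights-sym xx xy xz yz s (vx i) vz     = refl
weights-sym xx xy xz yz s vy     (vx i) = refl
weights-sym xx xy xz yz s vz     (vx i) = refl
weights-sym xx xy xz yz s vy     vz     = refl
weights-sym xx xy xz yz s vz     vy     = refl
weights-sym xx xy xz yz s vy     vy     = refl
weights-sym xx xy xz yz s vz     vz     = refl

weights-loopless : ∀ {n} xx xy xz yz → (∀ a → xx a a ≡ 0) →
                   ∀ (u : Vertex n) → weights xx xy xz yz u u ≡ 0
weights-loopless xx xy xz yz s (vx i) = s (index i)
weights-loopless xx xy xz yz s vy     = refl
weights-loopless xx xy xz yz s vz     = refl

pathEdge : ℕ → ℕ → ℕ
pathEdge a b = 𝟙 (consecutive a b)

-- The edge {x_c , x_(c+1)} is deleted.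
pathEdgeWithout : ℕ → ℕ → ℕ → ℕ
pathEdgeWithout c a b = 𝟙 (consecutive a b ∧ not (a ⊓ b ≡ᵇ c))

Qweights : ∀ n → Vertex n → Vertex n → ℕ
Qweights n = weights pathEdge (λ a → 𝟙 (a ≡ᵇ 1)) (λ a → 𝟙 (a ≡ᵇ 1)) 1

Rweights : ∀ n → ℕ → Vertex n → Vertex n → ℕ
Rweights n i = weights (pathEdgeWithout i)
                       (λ a → 𝟙 ((a ≡ᵇ i) ∨ (a ≡ᵇ suc i)))
                       (λ a → 𝟙 ((a ≡ᵇ i) ∨ (a ≡ᵇ suc i))) 1

Sweights : ∀ n → Vertex n → Vertex n → ℕ
Sweights n = weights pathEdge (λ a → 𝟙 (a ≡ᵇ 1)) (λ a → 𝟙 (a ≡ᵇ n ∸ 2)) (n ∸ 2)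

infix 4 _∈I_
_∈I_ : ℕ → ℕ → Set
i ∈I n = 1 ≤ i × i ≤ ⌈ n ∸ 3 /2⌉

private
  0<𝟙 : ∀ {b} → T b → 0 < 𝟙 b
  0<𝟙 {true} _ = s≤s z≤n

  gap : ∀ a → ∣ suc a - a ∣ ≡ 1
  gap zero    = refl
  gap (suc a) = gap a

  consecutive-sym : ∀ a b → consecutive a b ≡ consecutive b a
  consecutive-sym a b = cong (_≡ᵇ 1) (∣-∣-comm a b)

  T-consecutive : ∀ a → T (consecutive (suc a) a)
  T-consecutive a = ≡⇒≡ᵇ _ _ (gap a)

  T-without : ∀ {c} a → a ≢ c → T (consecutive (suc a) a ∧ not (suc a ⊓ a ≡ᵇ c))
  T-without {c} a a≢c rewrite gap a | m≥n⇒m⊓n≡n (n≤1+n a) with a ≡ᵇ c in eq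
  ... | false = _
  ... | true  = a≢c (≡ᵇ⇒≡ a c (subst T (sym eq) _))

  pathEdge-sym : ∀ a b → pathEdge a b ≡ pathEdge b a
  pathEdge-sym a b = cong 𝟙 (consecutive-sym a b)

  pathEdgeWithout-sym : ∀ c a b → pathEdgeWithout c a b ≡ pathEdgeWithout c b a
  pathEdgeWithout-sym c a b =
    cong₂ (λ p q → 𝟙 (p ∧ not (q ≡ᵇ c))) (consecutive-sym a b) (⊓-comm a b)

  pathEdge-irrefl : ∀ a → pathEdge a a ≡ 0
  pathEdge-irrefl a rewrite ∣n-n∣≡0 a = refl

  pathEdgeWithout-irrefl : ∀ c a → pathEdgeWithout c a a ≡ 0
  pathEdgeWithout-irrefl c a rewrite ∣n-n∣≡0 a = refl

  T-∨ˡ : ∀ {a b} → T a → T (a ∨ b)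
  T-∨ˡ {true} t = t

  T-∨ʳ : ∀ {a b} → T b → T (a ∨ b)
  T-∨ʳ {true}  t = _
  T-∨ʳ {false} t = t

  module _ {n : ℕ} (w : Vertex n → Vertex n → ℕ) {r : Vertex n} where
    open Walks w

    descend : ∀ lo →
      (∀ i → toℕ i ≡ lo → Walk (vx i) r) →
      (∀ i j → lo ≤ toℕ i → toℕ j ≡ suc (toℕ i) → Adjacent (vx j) (vx i)) →
      ∀ k i → toℕ i ≡ k + lo → Walk (vx i) r
    descend lo base edge zero    j eq = base j eq
    descend lo base edge (suc k) j eq =
      step (edge i j (subst (lo ≤_) (sym i≡) (m≤n+m lo k))
                     (trans eq (cong suc (sym i≡))))
           (descend lo base edge k i i≡)
      where
      bound : k + lo < n ∸ 2
      bound = ≤-trans (≤-reflexive (sym eq)) (<⇒≤ (Finₚ.toℕ<n j))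
      i : Fin (n ∸ 2)
      i = fromℕ< bound
      i≡ : toℕ i ≡ k + lo
      i≡ = Finₚ.toℕ-fromℕ< bound

    ascend : ∀ hi → hi < n ∸ 2 →
      (∀ i → toℕ i ≡ hi → Walk (vx i) r) →
      (∀ i j → toℕ j ≤ hi → toℕ j ≡ suc (toℕ i) → Adjacent (vx i) (vx j)) →
      ∀ k i → k + toℕ i ≡ hi → Walk (vx i) r
    ascend hi hi< base edge zero    i eq = base i eq
    ascend hi hi< base edge (suc k) i eq =
      step (edge i j (subst (_≤ hi) (sym j≡) j≤hi) j≡)
           (ascend hi hi< base edge k j
              (trans (cong (k +_) j≡) (trans (+-suc k (toℕ i)) eq)))
      where
      j≤hi : suc (toℕ i) ≤ hi
      j≤hi = ≤-trans (s≤s (m≤n+m (toℕ i) k)) (≤-reflexive eq)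
      bound : suc (toℕ i) < n ∸ 2
      bound = ≤-<-trans j≤hi hi<
      j : Fin (n ∸ 2)
      j = fromℕ< bound
      j≡ : toℕ j ≡ suc (toℕ i)
      j≡ = Finₚ.toℕ-fromℕ< bound

  pathEdge-down : ∀ {m} (i j : Fin m) → toℕ j ≡ suc (toℕ i) →
                  0 < pathEdge (index j) (index i)
  pathEdge-down i j eq rewrite eq = 0<𝟙 (T-consecutive (toℕ i))

  first : ∀ {m} (i : Fin m) → toℕ i ≡ 0 → 0 < 𝟙 (index i ≡ᵇ 1)
  first zero _ = s≤s z≤n

  Qconnected : ∀ n (u v : Vertex n) → Walks.Walk (Qweights n) u v
  Qconnected n = connectedVia (weights-sym pathEdge _ _ _ pathEdge-sym) vy λ where
      (vx i) → descend (Qweights n) 0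
                (λ i eq → step (first i eq) nil)
                (λ i j _ → pathEdge-down i j)
                (toℕ i) i (sym (+-identityʳ _))
      vy     → nil
      vz     → step (s≤s z≤n) nil
    where open Walks (Qweights n)

  Sconnected : ∀ n → 3 ≤ n → (u v : Vertex n) → Walks.Walk (Sweights n) u v
  Sconnected n n≥3 = connectedVia (weights-sym pathEdge _ _ _ pathEdge-sym) vy λ where
      (vx i) → descend (Sweights n) 0
                (λ i eq → step (first i eq) nil)
                (λ i j _ → pathEdge-down i j)
                (toℕ i) i (sym (+-identityʳ _))
      vy     → nil
      vz     → step (m<n⇒0<n∸m n≥3) nil
    where open Walks (Sweights n)

  Rconnected : ∀ n i → 4 ≤ n → i ∈I n → (u v : Vertex n) → Walks.Walk (Rweights n i) u v
  Rconnected n@(suc (suc (suc (suc n-4)))) c@(suc c-1) (s≤s (s≤s (s≤s (s≤s z≤n)))) (_ , c≤) =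
    connectedVia
      (weights-sym (pathEdgeWithout c) _ _ _ (pathEdgeWithout-sym c)) vy λ where
        (vx i) → fromPath i (≤-total c (toℕ i))
        vy     → nil
        vz     → step (s≤s z≤n) nil
    where
    open Walks (Rweights n c)

    c<n-2 : c < n ∸ 2
    c<n-2 = s≤s (≤-trans c≤ (⌈n/2⌉≤n (suc n-4)))

    toY : ∀ i → T ((index i ≡ᵇ c) ∨ (index i ≡ᵇ suc c)) → Walk (vx i) vy
    toY i t = step (0<𝟙 t) nil

    fromC : ∀ i → toℕ i ≡ c-1 → Walk (vx i) vy
    fromC i eq = toY i (T-∨ˡ (≡⇒≡ᵇ _ _ eq))

    fromSucC : ∀ i → toℕ i ≡ c → Walk (vx i) vy
    fromSucC i eq = toY i (T-∨ʳ {index i ≡ᵇ c} (≡⇒≡ᵇ _ _ eq))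

    edge : ∀ (i j : Fin (n ∸ 2)) → index i ≢ c → toℕ j ≡ suc (toℕ i) →
           0 < pathEdgeWithout c (index j) (index i)
    edge i j i≢c eq rewrite eq = 0<𝟙 (T-without (index i) i≢c)

    fromPath : ∀ i → c ≤ toℕ i ⊎ toℕ i ≤ c → Walk (vx i) vy
    fromPath i (inj₁ c≤i) =
      descend (Rweights n c) c fromSucC
        (λ i j c≤i → edge i j (λ eq → <⇒≢ (s≤s c≤i) (sym eq)))
        (toℕ i ∸ c) i (sym (m∸n+n≡m c≤i))
    fromPath i (inj₂ i≤c) with m≤n⇒m<n∨m≡n i≤c
    ... | inj₂ i≡c = fromSucC i i≡c
    ... | inj₁ (s≤s i≤c-1) =
      ascend (Rweights n c) c-1 (<⇒≤ c<n-2) fromC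
        (λ i j j≤ eq → subst (0 <_) (pathEdgeWithout-sym c (index j) (index i))
          (edge i j (λ eq′ → <⇒≢ (s≤s (≤-trans (≤-reflexive (sym eq)) j≤)) eq′) eq))
        (c-1 ∸ toℕ i) i (m∸n+n≡m i≤c-1)

Q : ∀ n → 3 ≤ n → Graph (vertexSet n)
Q n _ = record
  { w         = Qweights n
  ; w-sym     = weights-sym pathEdge _ _ _ pathEdge-sym
  ; loopless  = weights-loopless pathEdge _ _ _ pathEdge-irrefl
  ; connected = Qconnected n
  }

R : ∀ n i → 4 ≤ n → i ∈I n → Graph (vertexSet n)
R n i n≥4 i∈I = record
  { w         = Rweights n i
  ; w-sym     = weights-sym (pathEdgeWithout i) _ _ _ (pathEdgeWithout-sym i)
  ; loopless  = weights-loopless (pathEdgeWithout i) _ _ _ (pathEdgeWithout-irrefl i)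
  ; connected = Rconnected n i n≥4 i∈I
  }

S : ∀ n → 3 ≤ n → Graph (vertexSet n)
S n n≥3 = record
  { w         = Sweights n
  ; w-sym     = weights-sym pathEdge _ _ _ pathEdge-sym
  ; loopless  = weights-loopless pathEdge _ _ _ pathEdge-irrefl
  ; connected = Sconnected n n≥3
  }

𝓠 : ∀ n → 3 ≤ n → BetweennessStructure (vertexSet n)
𝓠 n n≥3 = induced (Q n n≥3)

𝓡 : ∀ n i → 4 ≤ n → i ∈I n → BetweennessStructure (vertexSet n)
𝓡 n i n≥4 i∈I = induced (R n i n≥4 i∈I)

𝓢 : ∀ n → 3 ≤ n → BetweennessStructure (vertexSet n)
𝓢 n n≥3 = induced (S n n≥3)

{-# OPTIONS --safe #-}
-- A structure is orderable iff its points can be ranked so that every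
-- betweenness is monotone in the ranks.  By P4 a four-point set of an orderable
-- structure never contains exactly one triangle, so a triangle {a, b, c} yields a
-- further triangle {d, u, v} with u, v ∈ {a, b, c} for each other point d: at
-- least n - 2 triangles in all.  If there are no more than that, every triangle
-- has at most one point outside any other one, which forces all of them to run
-- through a common pair {y, z}.  P4 then shows that y and z are either
-- consecutive (Q or R, up to reversing the order) or the two extremes (S).
module Submission where

open import Defs
open import Data.Bool using (true; false; T; _∨_; _∧_)
open import Data.Bool.Properties using (∧-identityʳ)
open import Data.Empty using (⊥; ⊥-elim)
open import Data.Fin using (Fin; zero; suc; toℕ; fromℕ<; punchIn; punchOut)
import Data.Fin.Properties as Finₚ
open import Data.List using (List; lookup; allFin; cartesianProduct)
open import Data.List.Membership.Propositional using (_∈_)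
open import Data.List.Membership.Propositional.Properties
  using (∈-filter⁺; ∈-filter⁻; ∈-cartesianProduct⁺; ∈-allFin; ∈-lookup)
import Data.List.Relation.Unary.All as All
open import Data.List.Relation.Unary.AllPairs using (_∷_)
import Data.List.Relation.Unary.Any as Any
open import Data.List.Relation.Unary.Any.Properties using (lookup-index)
open import Data.List.Relation.Unary.Unique.Propositional using (Unique)
import Data.List.Relation.Unary.Unique.Propositional.Properties as Unique
open import Data.Nat
open import Data.Nat.Properties
open import Data.Nat.Tactic.RingSolver using (solve-∀)
open import Data.Product using (∃₂; Σ-syntax; ∃-syntax; _×_; _,_; proj₁; proj₂)
open import Data.Sum using (_⊎_; inj₁; inj₂; [_,_]′)
open import Function using (_∘_; id)
open import Function.Bundles using (_↔_; _⇔_; Inverse; Equivalence; mk⇔; mk↔ₛ′)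
open import Function.Definitions using (Injective)
open import Relation.Binary.Definitions using (tri<; tri≈; tri>)
open import Relation.Binary.PropositionalEquality
open import Relation.Nullary
open import Relation.Nullary.Decidable using (decidable-stable; _⊎-dec_; _×-dec_)

open FiniteSet using (Carrier; size; enumeration)

-- The co-size is the length of a filtered list, so triangles are counted by injections into
-- `Fin coSize` or into the ground set. When the bound is attained, the pigeonhole principle turns
-- such an injection into an enumeration of all triangles; this is how minimality is used. Along the
-- order, a minimal structure is determined by the two ranks of the common pair, so isomorphism
-- reduces to comparing two numbers (`Shape p q`), and the listed graphs enter only through theirs.
-- Their distances come from a level function instead of an analysis of shortest paths, and an odd
-- perimeter shows that {y, z, x} is a triangle. This explains the weight n - 2 in S: it is one less
-- than the length n - 1 of the path from y to z, so the perimeter is 2n - 3, while no other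
-- distance drops. The range of i comes from reversal: if y and z have ranks c and c + 1, counted
-- from 0, then reversing the order replaces c by n - 2 - c. The value c = 0 gives Q, and the other
-- c with c ≤ n - 2 - c are those with 1 ≤ c ≤ ⌈(n - 3)/2⌉.

-- Injections between finite sets and positions in lists

-- If `y` were missed, deleting it from the codomain would leave an injection of `Fin m` into a set
-- with fewer than `m` elements.
injective⇒hits : ∀ {m k} (f : Fin m → Fin k) → Injective _≡_ _≡_ f → k ≤ m →
                 ∀ y → ∃[ x ] f x ≡ y
injective⇒hits {k = suc k} f inj k≤m y with Finₚ.any? (λ x → f x Finₚ.≟ y)
... | yes hit = hit
... | no miss = ⊥-elim (<⇒≱ k≤m (Finₚ.injective⇒≤ {f = λ x → punchOut (avoids x)}
                  (inj ∘ Finₚ.punchOut-injective (avoids _) (avoids _))))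
  where
  avoids : ∀ x → y ≢ f x
  avoids x eq = miss (x , sym eq)

abstract
  -- Two punctures in a row: `j` is first moved into the complement of `i`, so that the second
  -- puncture removes it there.
  avoiding₂ : ∀ {k} (i j : Fin k) → i ≢ j →
              Σ[ f ∈ (Fin (k ∸ 2) → Fin k) ]
                (Injective _≡_ _≡_ f × (∀ x → f x ≢ i) × (∀ x → f x ≢ j))
  avoiding₂ {1}           zero zero i≢j = ⊥-elim (i≢j refl)
  avoiding₂ {suc (suc k)} i    j    i≢j =
      (λ x → punchIn i (punchIn j′ x))
    , (λ eq → Finₚ.punchIn-injective j′ _ _ (Finₚ.punchIn-injective i _ _ eq))
    , (λ x → Finₚ.punchInᵢ≢i i _)
    , (λ x eq → Finₚ.punchInᵢ≢i j′ x (Finₚ.punchIn-injective i _ _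
                  (trans eq (sym (Finₚ.punchIn-punchOut i≢j)))))
    where
    j′ : Fin (suc k)
    j′ = punchOut i≢j

lookup-injective : ∀ {A : Set} {xs : List A} → Unique xs → Injective _≡_ _≡_ (lookup xs)
lookup-injective (_ ∷ _)  {zero}  {zero}  _  = refl
lookup-injective (x∉ ∷ _) {zero}  {suc j} eq = ⊥-elim (All.lookup x∉ (∈-lookup j) eq)
lookup-injective (x∉ ∷ _) {suc i} {zero}  eq = ⊥-elim (All.lookup x∉ (∈-lookup i) (sym eq))
lookup-injective (_ ∷ u)  {suc i} {suc j} eq = cong suc (lookup-injective u eq)

index-injective : ∀ {A : Set} {xs : List A} {x y} (x∈ : x ∈ xs) (y∈ : y ∈ xs) →
                  Any.index x∈ ≡ Any.index y∈ → x ≡ y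
index-injective {xs = xs} x∈ y∈ eq =
  trans (lookup-index x∈) (trans (cong (lookup xs) eq) (sym (lookup-index y∈)))

-- Triples

Triple : Set → Set
Triple A = A × A × A

infix 4 _∈₃_ _⊆₃_ _≈₃_

_∈₃_ : {A : Set} → A → Triple A → Set
x ∈₃ (a , b , c) = x ≡ a ⊎ x ≡ b ⊎ x ≡ c

pattern 1st eq = inj₁ eq
pattern 2nd eq = inj₂ (inj₁ eq)
pattern 3rd eq = inj₂ (inj₂ eq)

_⊆₃_ : {A : Set} → Triple A → Triple A → Set
t ⊆₃ t′ = ∀ {x} → x ∈₃ t → x ∈₃ t′

-- Triangles are unordered while triples are ordered; two triples name the same triangle when their
-- underlying sets agree.
_≈₃_ : {A : Set} → Triple A → Triple A → Set
t ≈₃ t′ = t ⊆₃ t′ × t′ ⊆₃ t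

⊆₃-intro : ∀ {A : Set} {a b c : A} {t} → a ∈₃ t → b ∈₃ t → c ∈₃ t → (a , b , c) ⊆₃ t
⊆₃-intro a∈ b∈ c∈ (1st refl) = a∈
⊆₃-intro a∈ b∈ c∈ (2nd refl) = b∈
⊆₃-intro a∈ b∈ c∈ (3rd refl) = c∈

∈₃-map : ∀ {A B : Set} (f : A → B) {x a b c} →
         x ∈₃ (a , b , c) → f x ∈₃ (f a , f b , f c)
∈₃-map f (1st refl) = 1st refl
∈₃-map f (2nd refl) = 2nd refl
∈₃-map f (3rd refl) = 3rd refl

∈₃-unmap : ∀ {A B : Set} {f : A → B} → Injective _≡_ _≡_ f → ∀ {x a b c} →
           f x ∈₃ (f a , f b , f c) → x ∈₃ (a , b , c)
∈₃-unmap inj (1st eq) = 1st (inj eq)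
∈₃-unmap inj (2nd eq) = 2nd (inj eq)
∈₃-unmap inj (3rd eq) = 3rd (inj eq)

Distinct : {A : Set} → Triple A → Set
Distinct (a , b , c) = a ≢ b × a ≢ c × b ≢ c

Increasing : {A : Set} → (A → ℕ) → Triple A → Set
Increasing h (a , b , c) = h a < h b × h b < h c

increasing⇒distinct : ∀ {A : Set} (h : A → ℕ) {t} → Increasing h t → Distinct t
increasing⇒distinct h (a<b , b<c) =
    <⇒≢ a<b ∘ cong h , <⇒≢ (<-trans a<b b<c) ∘ cong h , <⇒≢ b<c ∘ cong h

-- The ends of an increasing triple are the extremes of its underlying set, hence common to both
-- triples; the middle point is the one left over.
increasing-unique : ∀ {A : Set} (h : A → ℕ) → Injective _≡_ _≡_ h →
                    ∀ {t t′} → Increasing h t → Increasing h t′ → t ≈₃ t′ → t ≡ t′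
increasing-unique h inj {a , b , c} {a′ , b′ , c′} (a<b , b<c) (a′<b′ , b′<c′) (⊆ , ⊇)
  = cong₂ _,_ a≡ (cong₂ _,_ (b≡ (⊆ (2nd refl))) c≡)
  where
  least : ∀ {x a b c} → Increasing h (a , b , c) → x ∈₃ (a , b , c) → h a ≤ h x
  least (a<b , b<c) (1st refl) = ≤-refl
  least (a<b , b<c) (2nd refl) = <⇒≤ a<b
  least (a<b , b<c) (3rd refl) = <⇒≤ (<-trans a<b b<c)
  greatest : ∀ {x a b c} → Increasing h (a , b , c) → x ∈₃ (a , b , c) → h x ≤ h c
  greatest (a<b , b<c) (1st refl) = <⇒≤ (<-trans a<b b<c)
  greatest (a<b , b<c) (2nd refl) = <⇒≤ b<c
  greatest (a<b , b<c) (3rd refl) = ≤-refl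
  a≡ : a ≡ a′
  a≡ = inj (≤-antisym (least (a<b , b<c) (⊇ (1st refl))) (least (a′<b′ , b′<c′) (⊆ (1st refl))))
  c≡ : c ≡ c′
  c≡ = inj (≤-antisym (greatest (a′<b′ , b′<c′) (⊆ (3rd refl))) (greatest (a<b , b<c) (⊇ (3rd refl))))
  b≡ : b ∈₃ (a′ , b′ , c′) → b ≡ b′
  b≡ (1st b≡a′) = ⊥-elim (<⇒≢ a<b (cong h (trans a≡ (sym b≡a′))))
  b≡ (2nd b≡b′) = b≡b′
  b≡ (3rd b≡c′) = ⊥-elim (<⇒≢ b<c (cong h (trans b≡c′ (sym c≡))))

compareBy : ∀ {A : Set} (h : A → ℕ) → Injective _≡_ _≡_ h →
            ∀ {u v} → u ≢ v → h u < h v ⊎ h v < h u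
compareBy h inj {u} {v} u≢v with <-cmp (h u) (h v)
... | tri< lt _ _ = inj₁ lt
... | tri≈ _ eq _ = ⊥-elim (u≢v (inj eq))
... | tri> _ _ gt = inj₂ gt

abstract
  sort : ∀ {A : Set} (h : A → ℕ) → Injective _≡_ _≡_ h → ∀ t → Distinct t →
         ∃[ s ] Increasing h s × s ≈₃ t
  sort {A} h inj (x , y , z) (x≢y , x≢z , y≢z)
    with compareBy h inj x≢y | compareBy h inj y≢z | compareBy h inj x≢z
  ... | inj₁ x<y | inj₁ y<z | _        = (x , y , z) , (x<y , y<z) , id , id
  ... | inj₁ x<y | inj₂ z<y | inj₁ x<z = (x , z , y) , (x<z , z<y) , flip , flip
    where
    flip : ∀ {a b c : A} → (a , b , c) ⊆₃ (a , c , b)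
    flip = ⊆₃-intro (1st refl) (3rd refl) (2nd refl)
  ... | inj₁ x<y | inj₂ z<y | inj₂ z<x = (z , x , y) , (z<x , x<y)
    , ⊆₃-intro (3rd refl) (1st refl) (2nd refl) , ⊆₃-intro (2nd refl) (3rd refl) (1st refl)
  ... | inj₂ y<x | inj₁ y<z | inj₁ x<z = (y , x , z) , (y<x , x<z)
    , ⊆₃-intro (2nd refl) (1st refl) (3rd refl) , ⊆₃-intro (2nd refl) (1st refl) (3rd refl)
  ... | inj₂ y<x | inj₁ y<z | inj₂ z<x = (y , z , x) , (y<z , z<x)
    , ⊆₃-intro (2nd refl) (3rd refl) (1st refl) , ⊆₃-intro (3rd refl) (1st refl) (2nd refl)
  ... | inj₂ y<x | inj₂ z<y | _        = (z , y , x) , (z<y , y<x)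
    , ⊆₃-intro (3rd refl) (2nd refl) (1st refl) , ⊆₃-intro (3rd refl) (2nd refl) (1st refl)

point-injective : ∀ V → Injective _≡_ _≡_ (FiniteSet.point V)
point-injective V {i} {j} eq =
  trans (sym (strictlyInverseˡ i)) (trans (cong to eq) (strictlyInverseˡ j))
  where open Inverse (enumeration V)

-- Triangles of a betweenness structure

module Triangles {V : FiniteSet} (B : BetweennessStructure V) where
  open BetweennessStructure B

  Triangle : Triple (Carrier V) → Set
  Triangle (x , y , z) = ¬ Collinear x y z

  β-xyy : ∀ x y → β x y y
  β-xyy x y = P2 _ _ _ (P1 y x)

  β-xyx⇒≡ : ∀ {x y} → β x y x → x ≡ y
  β-xyx⇒≡ {x} {y} b = P3 x y x b (β-xyy y x)

  private
    swap₁₂ : ∀ {x y z} → Collinear x y z → Collinear y x z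
    swap₁₂ (inj₁ p)                             = inj₂ (inj₂ (inj₁ p))
    swap₁₂ (inj₂ (inj₁ p))                      = inj₂ (inj₂ (inj₂ (inj₁ p)))
    swap₁₂ (inj₂ (inj₂ (inj₁ p)))               = inj₁ p
    swap₁₂ (inj₂ (inj₂ (inj₂ (inj₁ p))))        = inj₂ (inj₁ p)
    swap₁₂ (inj₂ (inj₂ (inj₂ (inj₂ (inj₁ p))))) = inj₂ (inj₂ (inj₂ (inj₂ (inj₂ p))))
    swap₁₂ (inj₂ (inj₂ (inj₂ (inj₂ (inj₂ p))))) = inj₂ (inj₂ (inj₂ (inj₂ (inj₁ p))))

    swap₂₃ : ∀ {x y z} → Collinear x y z → Collinear x z y
    swap₂₃ (inj₁ p)                             = inj₂ (inj₁ p)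
    swap₂₃ (inj₂ (inj₁ p))                      = inj₁ p
    swap₂₃ (inj₂ (inj₂ (inj₁ p)))               = inj₂ (inj₂ (inj₂ (inj₂ (inj₁ p))))
    swap₂₃ (inj₂ (inj₂ (inj₂ (inj₁ p))))        = inj₂ (inj₂ (inj₂ (inj₂ (inj₂ p))))
    swap₂₃ (inj₂ (inj₂ (inj₂ (inj₂ (inj₁ p))))) = inj₂ (inj₂ (inj₁ p))
    swap₂₃ (inj₂ (inj₂ (inj₂ (inj₂ (inj₂ p))))) = inj₂ (inj₂ (inj₂ (inj₁ p)))

  -- A triple drawn from `a`, `b`, `c` either repeats an entry, and is then collinear by `P1` and
  -- `P2`, or is a permutation. Being a triangle thus depends on the point set alone.
  collinear-⊆₃ : ∀ {x y z a b c} → (x , y , z) ⊆₃ (a , b , c) →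
                 Collinear a b c → Collinear x y z
  collinear-⊆₃ {a = a} {b} {c} ⊆ col = go (⊆ (1st refl)) (⊆ (2nd refl)) (⊆ (3rd refl)) col
    where
    xxy : ∀ {u v} → Collinear u u v
    xxy = inj₁ (P1 _ _)
    xyy : ∀ {u v} → Collinear u v v
    xyy = inj₁ (β-xyy _ _)
    xyx : ∀ {u v} → Collinear u v u
    xyx = inj₂ (inj₂ (inj₁ (β-xyy _ _)))
    go : ∀ {x y z} → x ∈₃ (a , b , c) → y ∈₃ (a , b , c) → z ∈₃ (a , b , c) →
         Collinear a b c → Collinear x y z
    go (1st refl) (1st refl) _ _ = xxy
    go (2nd refl) (2nd refl) _ _ = xxy
    go (3rd refl) (3rd refl) _ _ = xxy
    go _ (1st refl) (1st refl) _ = xyy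
    go _ (2nd refl) (2nd refl) _ = xyy
    go _ (3rd refl) (3rd refl) _ = xyy
    go (1st refl) _ (1st refl) _ = xyx
    go (2nd refl) _ (2nd refl) _ = xyx
    go (3rd refl) _ (3rd refl) _ = xyx
    go (1st refl) (2nd refl) (3rd refl) p = p
    go (1st refl) (3rd refl) (2nd refl) p = swap₂₃ p
    go (2nd refl) (1st refl) (3rd refl) p = swap₁₂ p
    go (2nd refl) (3rd refl) (1st refl) p = swap₂₃ (swap₁₂ p)
    go (3rd refl) (1st refl) (2nd refl) p = swap₁₂ (swap₂₃ p)
    go (3rd refl) (2nd refl) (1st refl) p = swap₁₂ (swap₂₃ (swap₁₂ p))

  triangle-⊆₃ : ∀ {x y z t} → (x , y , z) ⊆₃ t → Triangle (x , y , z) → Triangle t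
  triangle-⊆₃ ⊆ tri = tri ∘ collinear-⊆₃ ⊆

  triangle⇒distinct : ∀ {t} → Triangle t → Distinct t
  triangle⇒distinct tri =
      (λ { refl → tri (inj₁ (P1 _ _)) })
    , (λ { refl → tri (inj₂ (inj₂ (inj₁ (β-xyy _ _)))) })
    , (λ { refl → tri (inj₁ (β-xyy _ _)) })

  private
    pt : Fin (size V) → Carrier V
    pt = FiniteSet.point V

    to : Carrier V → Fin (size V)
    to = Inverse.to (enumeration V)

    pt-to : ∀ x → pt (to x) ≡ x
    pt-to = Inverse.strictlyInverseʳ (enumeration V)

    to-pt : ∀ i → to (pt i) ≡ i
    to-pt = Inverse.strictlyInverseˡ (enumeration V)

    ix : Carrier V → ℕ
    ix = toℕ ∘ to

    ix-injective : Injective _≡_ _≡_ ix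
    ix-injective eq = trans (sym (pt-to _)) (trans (cong pt (Finₚ.toℕ-injective eq)) (pt-to _))

    pts : Triple (Fin (size V)) → Triple (Carrier V)
    pts (i , j , k) = pt i , pt j , pt k

    Listing : Triple (Carrier V) → Set
    Listing t = ∃[ s ] s ∈ triangles × pts s ≈₃ t

    listing : ∀ {t} → Triangle t → Listing t
    listing {t} tri with sort ix ix-injective t (triangle⇒distinct tri)
    ... | (a , b , c) , (a<b , b<c) , ⊆ , ⊇ =
        (to a , to b , to c)
      , ∈-filter⁺ isTriangle?
          (∈-cartesianProduct⁺ (∈-allFin _) (∈-cartesianProduct⁺ (∈-allFin _) (∈-allFin _)))
          (a<b , b<c , triangle-⊆₃ (there ∘ ⊇) tri)
      , ⊆ ∘ back , there ∘ ⊇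
      where
      there : (a , b , c) ⊆₃ pts (to a , to b , to c)
      there = ⊆₃-intro (1st (sym (pt-to a))) (2nd (sym (pt-to b))) (3rd (sym (pt-to c)))
      back : pts (to a , to b , to c) ⊆₃ (a , b , c)
      back = ⊆₃-intro (1st (pt-to a)) (2nd (pt-to b)) (3rd (pt-to c))

  abstract
    -- The position in the list that defines the co-size, found by sorting the triangle. It turns
    -- lower bounds on the co-size into injectivity statements.
    label : ∀ {t} → Triangle t → Fin coSize
    label tri = Any.index (proj₁ (proj₂ (listing tri)))

    label-injective : ∀ {t t′} (tri : Triangle t) (tri′ : Triangle t′) →
                      label tri ≡ label tri′ → t ≈₃ t′
    label-injective tri tri′ eq =
      ≈-trans (listing tri) (listing tri′)
        (index-injective (proj₁ (proj₂ (listing tri))) (proj₁ (proj₂ (listing tri′))) eq)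
      where
      ≈-trans : ∀ {t t′} (l : Listing t) (l′ : Listing t′) → proj₁ l ≡ proj₁ l′ → t ≈₃ t′
      ≈-trans (_ , _ , ⊆ , ⊇) (_ , _ , ⊆′ , ⊇′) refl = ⊆′ ∘ ⊇ , ⊆ ∘ ⊇′

  nth : Fin coSize → Triple (Carrier V)
  nth = pts ∘ lookup triangles

  private
    nth-isTriangle : ∀ i → IsTriangle (lookup triangles i)
    nth-isTriangle i = proj₂ (∈-filter⁻ isTriangle? {xs = triples} (∈-lookup i))
      where
      triples : List (Triple (Fin (size V)))
      triples = cartesianProduct (allFin _) (cartesianProduct (allFin _) (allFin _))

  nth-triangle : ∀ i → Triangle (nth i)
  nth-triangle i = proj₂ (proj₂ (nth-isTriangle i))

  nth-injective : ∀ {i j} → nth i ≈₃ nth j → i ≡ j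
  nth-injective {i} {j} (⊆ , ⊇) = lookup-injective unique
    (increasing-unique toℕ Finₚ.toℕ-injective (increasing i) (increasing j)
      ( ∈₃-unmap (point-injective V) ∘ ⊆ ∘ ∈₃-map pt
      , ∈₃-unmap (point-injective V) ∘ ⊇ ∘ ∈₃-map pt ))
    where
    increasing : ∀ i → Increasing toℕ (lookup triangles i)
    increasing i = proj₁ (nth-isTriangle i) , proj₁ (proj₂ (nth-isTriangle i))
    unique : Unique triangles
    unique = Unique.filter⁺ isTriangle?
      (Unique.cartesianProduct⁺ (Unique.allFin⁺ _)
        (Unique.cartesianProduct⁺ (Unique.allFin⁺ _) (Unique.allFin⁺ _)))

  Faithful : ∀ {m} {g : Fin m → Triple (Carrier V)} → (∀ i → Triangle (g i)) → Set
  Faithful {m} {g} tri = ∀ {i j} → g i ≈₃ g j → i ≡ j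

  coSize-≥ : ∀ {m} {g : Fin m → Triple (Carrier V)} (tri : ∀ i → Triangle (g i)) →
             Faithful tri → m ≤ coSize
  coSize-≥ tri faithful =
    Finₚ.injective⇒≤ {f = label ∘ tri} (faithful ∘ label-injective (tri _) (tri _))

  -- Pigeonhole on labels: a faithful family that is as long as the list of triangles leaves none
  -- out. Minimality of the co-size enters the classification through this.
  exhaustive : ∀ {m} {g : Fin m → Triple (Carrier V)} (tri : ∀ i → Triangle (g i)) →
               Faithful tri → coSize ≤ m → ∀ {t} → Triangle t → ∃[ i ] g i ≈₃ t
  exhaustive tri faithful ≤m t
    with injective⇒hits (label ∘ tri) (faithful ∘ label-injective (tri _) (tri _)) ≤m (label t)
  ... | i , eq = i , label-injective (tri i) t eq

  triangle? : 0 < coSize → ∃[ t ] Triangle t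
  triangle? 0< = nth i , nth-triangle i
    where
    i : Fin coSize
    i = fromℕ< 0<

  others : ∀ {x y} → x ≢ y →
           Σ[ f ∈ (Fin (size V ∸ 2) → Carrier V) ]
             (Injective _≡_ _≡_ f × (∀ i → f i ≢ x) × (∀ i → f i ≢ y))
  others x≢y with avoiding₂ _ _ (x≢y ∘ ix-injective ∘ cong toℕ)
  ... | f , f-inj , ≢x , ≢y =
      pt ∘ f , f-inj ∘ point-injective V
    , (λ i eq → ≢x i (trans (sym (to-pt _)) (cong to eq)))
    , (λ i eq → ≢y i (trans (sym (to-pt _)) (cong to eq)))

-- Triangles in a ranked structure and the lower bound

Monotone : ℕ → ℕ → ℕ → Set
Monotone a b c = (a ≤ b × b ≤ c) ⊎ (c ≤ b × b ≤ a)

module Heights {V : FiniteSet} (B : BetweennessStructure V)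
  (h : Carrier V → ℕ) (h-injective : Injective _≡_ _≡_ h)
  (monotone : ∀ x y z → BetweennessStructure.β B x y z → Monotone (h x) (h y) (h z))
  where
  open BetweennessStructure B
  open Triangles B
  open FiniteSet V using (_≟ᵥ_; any?)

  height-cmp : ∀ {x y} → x ≢ y → h x < h y ⊎ h y < h x
  height-cmp = compareBy h h-injective

  private
    low-middle : ∀ {x y z} → h y < h x → h y < h z → ¬ β x y z
    low-middle y<x y<z p with monotone _ _ _ p
    ... | inj₁ (x≤y , _) = <⇒≱ y<x x≤y
    ... | inj₂ (z≤y , _) = <⇒≱ y<z z≤y

    high-middle : ∀ {x y z} → h x < h y → h z < h y → ¬ β x y z
    high-middle x<y z<y p with monotone _ _ _ p
    ... | inj₁ (_ , y≤z) = <⇒≱ z<y y≤z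
    ... | inj₂ (_ , y≤x) = <⇒≱ x<y y≤x

    exchange : ∀ {x y z} → Collinear x y z → Collinear y x z
    exchange = collinear-⊆₃ (⊆₃-intro (2nd refl) (1st refl) (3rd refl))

    rotate : ∀ {x y z} → Collinear x y z → Collinear y z x
    rotate = collinear-⊆₃ (⊆₃-intro (2nd refl) (3rd refl) (1st refl))

  -- The middle point of a betweenness has the middle height, so of the six possible orderings only
  -- this one and its reversal survive.
  sorted-β : ∀ {x y z} → Increasing h (x , y , z) → Collinear x y z → β x y z
  sorted-β (x<y , y<z) (inj₁ p) = p
  sorted-β (x<y , y<z) (inj₂ (inj₁ p)) = ⊥-elim (high-middle (<-trans x<y y<z) y<z p)
  sorted-β (x<y , y<z) (inj₂ (inj₂ (inj₁ p))) = ⊥-elim (low-middle x<y (<-trans x<y y<z) p)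
  sorted-β (x<y , y<z) (inj₂ (inj₂ (inj₂ (inj₁ p)))) =
    ⊥-elim (high-middle y<z (<-trans x<y y<z) p)
  sorted-β (x<y , y<z) (inj₂ (inj₂ (inj₂ (inj₂ (inj₁ p))))) =
    ⊥-elim (low-middle (<-trans x<y y<z) x<y p)
  sorted-β (x<y , y<z) (inj₂ (inj₂ (inj₂ (inj₂ (inj₂ p))))) = P2 _ _ _ p

  -- Along the order, P4 says that for p < q < r < s the triples pqr and prs are
  -- both collinear iff pqs and qrs are; so a four-point set never contains
  -- exactly one triangle.
  collinear-through : ∀ {a b c d} → Increasing h (a , b , c) → d ≢ a → d ≢ b → d ≢ c →
    Collinear d a b → Collinear d a c → Collinear d b c → Collinear a b c
  collinear-through {a} {b} {c} {d} (a<b , b<c) d≢a d≢b d≢c dab dac dbc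
    with height-cmp d≢a | height-cmp d≢b | height-cmp d≢c
  ... | inj₁ d<a | _ | _ = inj₁ (proj₂ (P4 d b c a
          (sorted-β (<-trans d<a a<b , b<c) dbc) (sorted-β (d<a , a<b) dab)))
  ... | inj₂ a<d | inj₁ d<b | _ = inj₁ (P2 _ _ _ (proj₁ (P4 c d a b
          (P2 _ _ _ (sorted-β (a<d , <-trans d<b b<c) (exchange dac)))
          (P2 _ _ _ (sorted-β (d<b , b<c) dbc)))))
  ... | inj₂ a<d | inj₂ b<d | inj₁ d<c = inj₁ (proj₁ (P4 a d c b
          (sorted-β (a<d , d<c) (exchange dac)) (sorted-β (a<b , b<d) (rotate dab))))
  ... | inj₂ a<d | inj₂ b<d | inj₂ c<d = inj₁ (P2 _ _ _ (proj₂ (P4 d b a c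
          (P2 _ _ _ (sorted-β (a<b , b<d) (rotate dab)))
          (P2 _ _ _ (sorted-β (b<c , c<d) (rotate dbc))))))

  Neighbour : Triple (Carrier V) → Carrier V → Set
  Neighbour t d = ∃₂ λ u v → ∃[ w ] ((u , v , w) ≈₃ t × Triangle (d , u , v))

  abstract
    neighbour : ∀ {t d} → Triangle t → ¬ d ∈₃ t → Neighbour t d
    neighbour {t} {d} tri d∉ with sort h h-injective t (triangle⇒distinct tri)
    ... | (a , b , c) , incr , ⊆ , ⊇ with collinear? d a b | collinear? d a c | collinear? d b c
    ... | no dab | _ | _ = a , b , c , (⊆ , ⊇) , dab
    ... | yes _ | no dac | _ = a , c , b
          , ( ⊆ ∘ ⊆₃-intro (1st refl) (3rd refl) (2nd refl)
            , ⊆₃-intro (1st refl) (3rd refl) (2nd refl) ∘ ⊇ ) , dac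
    ... | yes _ | yes _ | no dbc = b , c , a
          , ( ⊆ ∘ ⊆₃-intro (2nd refl) (3rd refl) (1st refl)
            , ⊆₃-intro (3rd refl) (1st refl) (2nd refl) ∘ ⊇ ) , dbc
    ... | yes dab | yes dac | yes dbc = ⊥-elim (triangle-⊆₃ ⊇ tri
          (collinear-through incr (λ { refl → d∉ (⊆ (1st refl)) })
            (λ { refl → d∉ (⊆ (2nd refl)) }) (λ { refl → d∉ (⊆ (3rd refl)) }) dab dac dbc))

  _∈₃?_ : ∀ x t → Dec (x ∈₃ t)
  x ∈₃? (a , b , c) = (x ≟ᵥ a) ⊎-dec (x ≟ᵥ b) ⊎-dec (x ≟ᵥ c)

  -- A vertex of `t` is served by `t` itself. The family below runs over the points other than `a`
  -- and `b`, so `c` contributes the base triangle and the remaining `n - 3` points one further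
  -- triangle each.
  Spoke : Triple (Carrier V) → Carrier V → Set
  Spoke t d = ∃[ s ] Triangle s × d ∈₃ s × (∀ {x} → x ∈₃ s → x ≡ d ⊎ x ∈₃ t)

  abstract
    spoke : ∀ {t} → Triangle t → ∀ d → Spoke t d
    spoke {t} tri d with d ∈₃? t
    ... | yes d∈ = t , tri , d∈ , inj₂
    ... | no d∉ with neighbour tri d∉
    ...   | u , v , w , (⊆ , _) , duv = (d , u , v) , duv , 1st refl , λ where
              (1st eq)   → inj₁ eq
              (2nd refl) → inj₂ (⊆ (1st refl))
              (3rd refl) → inj₂ (⊆ (2nd refl))

  module _ {a b c} (tri : Triangle (a , b , c)) where
    private
      V∖ab = others (proj₁ (triangle⇒distinct tri))

    outer : Fin (size V ∸ 2) → Carrier V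
    outer = proj₁ V∖ab

    spokes : ∀ i → Triangle (proj₁ (spoke tri (outer i)))
    spokes i = proj₁ (proj₂ (spoke tri (outer i)))

    -- Equal spokes contain each other's hubs. Hence the hubs coincide, or both lie in the base
    -- triangle, where only `c` is possible as `a` and `b` are left out of `outer`.
    spokes-faithful : Faithful spokes
    spokes-faithful {i} {j} (⊆ , ⊇) =
      proj₁ (proj₂ V∖ab) (agree (spread j (⊆ (hub i))) (spread i (⊇ (hub j))))
      where
      hub : ∀ i → outer i ∈₃ proj₁ (spoke tri (outer i))
      hub i = proj₁ (proj₂ (proj₂ (spoke tri (outer i))))
      spread : ∀ i {x} → x ∈₃ proj₁ (spoke tri (outer i)) → x ≡ outer i ⊎ x ∈₃ (a , b , c)
      spread i = proj₂ (proj₂ (proj₂ (spoke tri (outer i))))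
      ≢a = proj₁ (proj₂ (proj₂ V∖ab))
      ≢b = proj₂ (proj₂ (proj₂ V∖ab))
      is-c : ∀ k → outer k ∈₃ (a , b , c) → outer k ≡ c
      is-c k (1st eq) = ⊥-elim (≢a k eq)
      is-c k (2nd eq) = ⊥-elim (≢b k eq)
      is-c k (3rd eq) = eq
      agree : outer i ≡ outer j ⊎ outer i ∈₃ (a , b , c) →
              outer j ≡ outer i ⊎ outer j ∈₃ (a , b , c) → outer i ≡ outer j
      agree (inj₁ eq) _         = eq
      agree (inj₂ _)  (inj₁ eq) = sym eq
      agree (inj₂ i∈) (inj₂ j∈) = trans (is-c i i∈) (sym (is-c j j∈))

    size∸2≤coSize : size V ∸ 2 ≤ coSize
    size∸2≤coSize = coSize-≥ spokes spokes-faithful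

  -- Structures with at most n - 2 triangles

  module Extremal (minimal : coSize ≤ size V ∸ 2) where

    -- The spokes of `t` already exhaust the triangles, so `t′` is one of them, and `e` is its hub.
    nearby : ∀ {t t′} → Triangle t → Triangle t′ → ∃[ e ] (∀ {x} → x ∈₃ t′ → x ≡ e ⊎ x ∈₃ t)
    nearby {t} {t′} tri tri′
      with exhaustive (spokes tri) (spokes-faithful tri) minimal {t′} tri′
    ... | i , _ , ⊇ = outer tri i , proj₂ (proj₂ (proj₂ (spoke tri (outer tri i)))) ∘ ⊇

    AllThrough : Carrier V → Carrier V → Set
    AllThrough Y Z = ∀ {x} → x ≢ Y → x ≢ Z → Triangle (Y , Z , x)

    private
      -- Any further x spans a triangle {x, s, t} with two of u, v, w.  As at most
      -- one of its points lies outside {d, u, v}, {s, t} must be {u, v}.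
      pair-case : ∀ {u v w d} → Triangle (u , v , w) → ¬ d ∈₃ (u , v , w) →
                  Triangle (d , u , v) → AllThrough u v
      pair-case {u} {v} {w} {d} uvw d∉ duv {x} x≢u x≢v with x ≟ᵥ w | x ≟ᵥ d
      ... | yes refl | _        = uvw
      ... | no _     | yes refl = triangle-⊆₃ (⊆₃-intro (3rd refl) (1st refl) (2nd refl)) duv
      ... | no x≢w   | no x≢d   with neighbour {d = x} uvw
                                       [ x≢u , [ x≢v , x≢w ]′ ]′
      ...   | s , t , r , (⊆ , _) , xst with nearby duv xst
      ...     | e , near = triangle-⊆₃
                  (⊆₃-intro (3rd refl) (common (2nd refl) s≢x (⊆ (1st refl)))
                                       (common (3rd refl) t≢x (⊆ (2nd refl)))) xst
        where
        s≢x : s ≢ x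
        s≢x = proj₁ (triangle⇒distinct xst) ∘ sym
        t≢x : t ≢ x
        t≢x = proj₁ (proj₂ (triangle⇒distinct xst)) ∘ sym
        x≡e : x ≡ e
        x≡e with near (1st refl)
        ... | inj₁ eq       = eq
        ... | inj₂ (1st eq) = ⊥-elim (x≢d eq)
        ... | inj₂ (2nd eq) = ⊥-elim (x≢u eq)
        ... | inj₂ (3rd eq) = ⊥-elim (x≢v eq)
        common : ∀ {y} → y ∈₃ (x , s , t) → y ≢ x → y ∈₃ (u , v , w) → y ∈₃ (u , v , x)
        common y∈ y≢x y∈uvw with near y∈
        ... | inj₁ eq         = ⊥-elim (y≢x (trans eq (sym x≡e)))
        ... | inj₂ (1st refl) = ⊥-elim (d∉ y∈uvw)
        ... | inj₂ (2nd eq)   = 1st eq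
        ... | inj₂ (3rd eq)   = 2nd eq

    common-pair : ∀ {a b c} → Triangle (a , b , c) → ∃₂ λ Y Z → Y ≢ Z × AllThrough Y Z
    common-pair {a} {b} {c} tri with any? (λ d → ¬? (d ∈₃? (a , b , c)))
    ... | yes (d , d∉) with neighbour tri d∉
    ...   | u , v , w , (⊆ , ⊇) , duv =
            u , v , proj₂ (proj₂ (triangle⇒distinct duv))
          , pair-case (triangle-⊆₃ ⊇ tri) (d∉ ∘ ⊆) duv
    -- The ground set is the triangle itself here, and any two of its points will do.
    common-pair {a} {b} {c} tri | no none = a , b , proj₁ (triangle⇒distinct tri) , through
      where
      through : AllThrough a b
      through {x} x≢a x≢b with x ∈₃? (a , b , c)
      ... | yes (1st eq)   = ⊥-elim (x≢a eq)
      ... | yes (2nd eq)   = ⊥-elim (x≢b eq)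
      ... | yes (3rd refl) = tri
      ... | no x∉          = ⊥-elim (none (x , x∉))

    -- The `n - 2` triangles `{Y, Z, x}` already use up the whole co-size.
    contains-pair : ∀ {Y Z} → Y ≢ Z → AllThrough Y Z →
                    ∀ {t} → Triangle t → Y ∈₃ t × Z ∈₃ t
    contains-pair {Y} {Z} Y≢Z through {t} tri
      with exhaustive (λ i → through (≢Y i) (≢Z i)) faithful minimal {t} tri
      where
      rest = others Y≢Z
      ≢Y = proj₁ (proj₂ (proj₂ rest))
      ≢Z = proj₂ (proj₂ (proj₂ rest))
      faithful : Faithful (λ i → through (≢Y i) (≢Z i))
      faithful {i} {j} (⊆ , _) with ⊆ (3rd refl)
      ... | 1st eq = ⊥-elim (≢Y i eq)
      ... | 2nd eq = ⊥-elim (≢Z i eq)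
      ... | 3rd eq = proj₁ (proj₂ rest) eq
    ... | i , ⊆ , _ = ⊆ (1st refl) , ⊆ (2nd refl)

-- Rankings and orderability

-- A linear order given by positions counted from 0. Injectivity and the bound make every position
-- occupied by counting; this is `attained`.
record Ranking (V : FiniteSet) : Set where
  field
    rank      : Carrier V → ℕ
    injective : Injective _≡_ _≡_ rank
    bounded   : ∀ x → rank x < size V

  abstract
    attained : ∀ {k} → k < size V → ∃[ x ] rank x ≡ k
    attained {k} k< with injective⇒hits f f-injective ≤-refl (fromℕ< k<)
      where
      f : Fin (size V) → Fin (size V)
      f i = fromℕ< (bounded (FiniteSet.point V i))
      f-injective : Injective _≡_ _≡_ f
      f-injective eq = point-injective V (injective (Finₚ.fromℕ<-injective _ _ _ _ eq))
    ... | i , eq = FiniteSet.point V i , Finₚ.fromℕ<-injective _ _ _ _ eq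

  at : ∀ {k} → k < size V → Carrier V
  at = proj₁ ∘ attained

  rank-at : ∀ {k} (k< : k < size V) → rank (at k<) ≡ k
  rank-at = proj₂ ∘ attained

  at-unique : ∀ {k} (k< : k < size V) {x} → rank x ≡ k → at k< ≡ x
  at-unique k< eq = injective (trans (rank-at k<) (sym eq))

  bijection : Fin (size V) ↔ Carrier V
  bijection = mk↔ₛ′ (at ∘ Finₚ.toℕ<n) (λ x → fromℕ< (bounded x))
    (λ x → at-unique _ (sym (Finₚ.toℕ-fromℕ< (bounded x))))
    (λ i → trans (Finₚ.fromℕ<-cong _ _ (rank-at _) _ (Finₚ.toℕ<n i)) (Finₚ.fromℕ<-toℕ i _))


Respects : {V : FiniteSet} → Ranking V → BetweennessStructure V → Set
Respects r B = ∀ x y z → BetweennessStructure.β B x y z →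
               Monotone (Ranking.rank r x) (Ranking.rank r y) (Ranking.rank r z)

module PathGraph {V : FiniteSet} (r : Ranking V) (G : Graph V)
  (gap-1 : ∀ {u v} → Graph.Adjacent G u v → ∣ Ranking.rank r u - Ranking.rank r v ∣ ≡ 1) where
  open Graph G
  open BetweennessStructure (induced G)
  private
    h : Carrier V → ℕ
    h = Ranking.rank r

  -- A discrete intermediate value argument: each edge changes the rank by exactly one, so a walk
  -- cannot jump over `t`. Nothing is assumed about the weights of the path, hence walks are cut
  -- rather than their lengths computed.
  split : ∀ {u v} t → h u ≤ h t → h t ≤ h v → (p : Walk u v) →
          Σ[ q ∈ Walk u t ] Σ[ q′ ∈ Walk t v ] len q + len q′ ≡ len p
  split {u} t u≤t t≤v p with m≤n⇒m<n∨m≡n u≤t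
  split t u≤t t≤v p | inj₂ eq with refl ← Ranking.injective r eq = nil , p , refl
  split t u≤t t≤v nil | inj₁ u<t = ⊥-elim (<⇒≱ u<t t≤v)
  split {u} t u≤t t≤v (step {v = s} e p) | inj₁ u<t
    with split t (≤-trans s≤1+u u<t) t≤v p
    where
    s≤1+u : h s ≤ suc (h u)
    s≤1+u = subst (h s ≤_) (trans (cong (h u +_) (gap-1 e)) (+-comm (h u) 1))
              (m≤n+∣n-m∣ (h s) (h u))
  ... | q , q′ , eq = step e q , q′ , trans (+-assoc (w u s) _ _) (cong (w u s +_) eq)

  increasing⇒β : ∀ {x y z} → h x ≤ h y → h y ≤ h z → β x y z
  increasing⇒β {x} {y} {z} x≤y y≤z with d-walk x z
  ... | p , len≡ with split y x≤y y≤z p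
  ...   | q , q′ , eq = ≤-antisym (d-triangle x y z)
            (≤-trans (+-mono-≤ (d≤len q) (d≤len q′)) (≤-reflexive (trans eq len≡)))

  monotone⇒β : ∀ {x y z} → Monotone (h x) (h y) (h z) → β x y z
  monotone⇒β (inj₁ (x≤y , y≤z)) = increasing⇒β x≤y y≤z
  monotone⇒β (inj₂ (z≤y , y≤x)) = P2 _ _ _ (increasing⇒β z≤y y≤x)

  -- If the ranks were not monotone, `increasing⇒β` would put another of the three points in the
  -- middle as well, and `P3` would identify the two middle points.
  respects : Respects r (induced G)
  respects x y z xyz with ≤-total (h x) (h y) | ≤-total (h y) (h z) | ≤-total (h x) (h z)
  ... | inj₁ x≤y | inj₁ y≤z | _        = inj₁ (x≤y , y≤z)
  ... | inj₂ y≤x | inj₂ z≤y | _        = inj₂ (z≤y , y≤x)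
  ... | inj₁ x≤y | inj₂ z≤y | inj₁ x≤z
    with refl ← P3 y z x (P2 _ _ _ (increasing⇒β x≤z z≤y)) (P2 _ _ _ xyz) = inj₁ (x≤y , ≤-refl)
  ... | inj₁ x≤y | inj₂ z≤y | inj₂ z≤x
    with refl ← P3 x y z xyz (P2 _ _ _ (increasing⇒β z≤x x≤y)) = inj₂ (z≤y , ≤-refl)
  ... | inj₂ y≤x | inj₁ y≤z | inj₁ x≤z
    with refl ← P3 x y z xyz (increasing⇒β y≤x x≤z) = inj₁ (≤-refl , y≤z)
  ... | inj₂ y≤x | inj₁ y≤z | inj₂ z≤x
    with refl ← P3 y z x (increasing⇒β y≤z z≤x) (P2 _ _ _ xyz) = inj₂ (≤-refl , y≤x)

orderable⇒ranking : ∀ {V} {B : BetweennessStructure V} → Orderable B →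
                    Σ[ r ∈ Ranking V ] Respects r B
orderable⇒ranking {V} {B} (B′ , B⊆B′ , G , (σ , path) , B′≡G) =
  r , λ x y z → PathGraph.respects r G gap-1 x y z
                  ∘ Equivalence.to (B′≡G x y z) ∘ B⊆B′ x y z
  where
  open Inverse σ
  r : Ranking V
  r = record
    { rank      = toℕ ∘ from
    ; injective = λ {x} {y} eq → trans (sym (strictlyInverseˡ x))
                    (trans (cong to (Finₚ.toℕ-injective eq)) (strictlyInverseˡ y))
    ; bounded   = λ x → Finₚ.toℕ<n (from x)
    }
  gap-1 : ∀ {u v} → Graph.Adjacent G u v → ∣ Ranking.rank r u - Ranking.rank r v ∣ ≡ 1
  gap-1 {u} {v} adj = Equivalence.to (path (from u) (from v))
    (subst₂ (Graph.Adjacent G) (sym (strictlyInverseˡ u)) (sym (strictlyInverseˡ v)) adj)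

𝟙-positive : ∀ {b} → 0 < 𝟙 b → T b
𝟙-positive {true} _ = _

positive-𝟙 : ∀ {b} → T b → 0 < 𝟙 b
positive-𝟙 {true} _ = s≤s z≤n

consecutive⇒gap : ∀ a b → 0 < pathEdge a b → ∣ a - b ∣ ≡ 1
consecutive⇒gap a b = ≡ᵇ⇒≡ ∣ a - b ∣ 1 ∘ 𝟙-positive

gap⇒consecutive : ∀ a b → ∣ a - b ∣ ≡ 1 → 0 < pathEdge a b
gap⇒consecutive a b = positive-𝟙 ∘ ≡⇒≡ᵇ ∣ a - b ∣ 1

∣1+a-a∣≡1 : ∀ a → ∣ suc a - a ∣ ≡ 1
∣1+a-a∣≡1 zero    = refl
∣1+a-a∣≡1 (suc a) = ∣1+a-a∣≡1 a

-- The ordered extension is induced by the unit-weight path that visits the points by rank, in which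
-- every monotone triple is a betweenness.
ranking⇒orderable : ∀ {V} {B : BetweennessStructure V} (r : Ranking V) → Respects r B →
                    Orderable B
ranking⇒orderable {V} {B} r respects =
    induced G
  , (λ x y z → PathGraph.monotone⇒β r G gap-1 ∘ respects x y z)
  , G , (bijection , isPath)
  , λ x y z → mk⇔ id id
  where
  open Ranking r
  w : Carrier V → Carrier V → ℕ
  w u v = pathEdge (rank u) (rank v)
  w-sym : ∀ u v → w u v ≡ w v u
  w-sym u v = cong (λ k → 𝟙 (k ≡ᵇ 1)) (∣-∣-comm (rank u) (rank v))
  open Walks w
  0< : 0 < size V
  0< = >-nonZero⁻¹ (size V) ⦃ FiniteSet.nonempty V ⦄
  descend : ∀ k u → rank u ≡ k → Walk u (at 0<)
  descend zero    u eq = subst (Walk u) (sym (Ranking.at-unique r 0< eq)) nil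
  descend (suc k) u eq = step (gap⇒consecutive (rank u) _
      (trans (cong₂ ∣_-_∣ eq (rank-at k<)) (∣1+a-a∣≡1 k))) (descend k (at k<) (rank-at k<))
    where
    k< : k < size V
    k< = <⇒≤ (subst (_< size V) eq (bounded u))
  G : Graph V
  G = record
    { w         = w
    ; w-sym     = w-sym
    ; loopless  = λ u → cong (λ k → 𝟙 (k ≡ᵇ 1)) (∣n-n∣≡0 (rank u))
    ; connected = connectedVia w-sym (at 0<) (λ u → descend _ u refl)
    }
  isPath : ∀ i j → 0 < w (Inverse.to bijection i) (Inverse.to bijection j) ⇔ ∣ toℕ i - toℕ j ∣ ≡ 1
  isPath i j = mk⇔ (trans (sym gap≡) ∘ consecutive⇒gap a b) (gap⇒consecutive a b ∘ trans gap≡)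
    where
    a = rank (Inverse.to bijection i)
    b = rank (Inverse.to bijection j)
    gap≡ : ∣ a - b ∣ ≡ ∣ toℕ i - toℕ j ∣
    gap≡ = cong₂ ∣_-_∣ (rank-at (Finₚ.toℕ<n i)) (rank-at (Finₚ.toℕ<n j))
  gap-1 : ∀ {u v} → 0 < w u v → ∣ rank u - rank v ∣ ≡ 1
  gap-1 {u} {v} = consecutive⇒gap (rank u) (rank v)

--8<--
open BetweennessStructure using (coSize)

-- Shapes

-- Y and Z are the points that the paper calls y and z: the only triangles are
-- those through both.
record Shape (p q : ℕ) {V : FiniteSet} (B : BetweennessStructure V) : Set where
  open BetweennessStructure B hiding (coSize)
  field
    ranking : Ranking V
  open Ranking ranking public
  field
    respects : Respects ranking B
    Y Z      : Carrier V
    rank-Y   : rank Y ≡ p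
    rank-Z   : rank Z ≡ q
    straight : ∀ {x y z} → Increasing rank (x , y , z) →
               ¬ (Y ∈₃ (x , y , z) × Z ∈₃ (x , y , z)) → β x y z
    bent     : ∀ {x y z} → Increasing rank (x , y , z) →
               Y ∈₃ (x , y , z) → Z ∈₃ (x , y , z) → ¬ β x y z

module _ {p q} {V W : FiniteSet} {B : BetweennessStructure V} {C : BetweennessStructure W}
         (s : Shape p q B) (s′ : Shape p q C) (f : Carrier V → Carrier W)
         (rank-f : ∀ x → Shape.rank s′ (f x) ≡ Shape.rank s x) where
  private
    module S = Shape s
    module S′ = Shape s′
    module B = BetweennessStructure B
    module C = BetweennessStructure C

    reflects-< : ∀ {x y} → S.rank x < S.rank y → S′.rank (f x) < S′.rank (f y)
    reflects-< = subst₂ _<_ (sym (rank-f _)) (sym (rank-f _))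

    f-injective : Injective _≡_ _≡_ f
    f-injective eq = S.injective (trans (sym (rank-f _)) (trans (cong S′.rank eq) (rank-f _)))

    f-Y : S′.Y ≡ f S.Y
    f-Y = S′.injective (trans S′.rank-Y (trans (sym S.rank-Y) (sym (rank-f S.Y))))

    f-Z : S′.Z ≡ f S.Z
    f-Z = S′.injective (trans S′.rank-Z (trans (sym S.rank-Z) (sym (rank-f S.Z))))

    increasing-β : ∀ {x y z} → S.rank x ≤ S.rank y → S.rank y ≤ S.rank z →
                   B.β x y z → C.β (f x) (f y) (f z)
    increasing-β x≤y y≤z xyz with m≤n⇒m<n∨m≡n x≤y | m≤n⇒m<n∨m≡n y≤z
    ... | inj₂ eq  | _        with refl ← S.injective eq = C.P1 _ _
    ... | inj₁ _   | inj₂ eq  with refl ← S.injective eq = Triangles.β-xyy C _ _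
    ... | inj₁ x<y | inj₁ y<z = S′.straight (reflects-< x<y , reflects-< y<z) λ (Y∈ , Z∈) →
      S.bent (x<y , y<z) (∈₃-unmap f-injective (subst (_∈₃ _) f-Y Y∈))
                         (∈₃-unmap f-injective (subst (_∈₃ _) f-Z Z∈)) xyz

  -- Up to reversal and degenerate triples, the betweennesses of a shape are the increasing triples
  -- that miss `Y` or `Z`. This description mentions ranks only, and `f` preserves those.
  shape-transport : ∀ {x y z} → B.β x y z → C.β (f x) (f y) (f z)
  shape-transport xyz with S.respects _ _ _ xyz
  ... | inj₁ (x≤y , y≤z) = increasing-β x≤y y≤z xyz
  ... | inj₂ (z≤y , y≤x) = C.P2 _ _ _ (increasing-β z≤y y≤x (B.P2 _ _ _ xyz))

module _ {V W : FiniteSet} (size≡ : size V ≡ size W)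
         {B : BetweennessStructure V} {C : BetweennessStructure W} where

  shape⇒≅ : ∀ {p q} → Shape p q B → Shape p q C → B ≅ C
  shape⇒≅ s s′ = record
    { bijection = mk↔ₛ′ f g
        (λ y → S′.injective (trans (rank-f (g y)) (rank-g y)))
        (λ x → S.injective (trans (rank-g (f x)) (rank-f x)))
    ; preserves = λ x y z → mk⇔ (shape-transport s s′ f rank-f)
        (λ fxyz → subst (λ (x , y , z) → BetweennessStructure.β B x y z)
          (cong₂ _,_ (g∘f x) (cong₂ _,_ (g∘f y) (g∘f z)))
          (shape-transport s′ s g rank-g fxyz))
    }
    where
    module S = Shape s
    module S′ = Shape s′
    f : Carrier V → Carrier W
    f x = S′.at (subst (S.rank x <_) size≡ (S.bounded x))
    rank-f : ∀ x → S′.rank (f x) ≡ S.rank x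
    rank-f x = S′.rank-at _
    g : Carrier W → Carrier V
    g y = S.at (subst (S′.rank y <_) (sym size≡) (S′.bounded y))
    rank-g : ∀ y → S.rank (g y) ≡ S′.rank y
    rank-g y = S.rank-at _
    g∘f : ∀ x → g (f x) ≡ x
    g∘f x = S.injective (trans (rank-g (f x)) (rank-f x))

  -- Carries orderability and co-size along an isomorphism in one go, since both can be read off
  -- from a shape.
  shape-pullback : ∀ {p q} → B ≅ C → Shape p q C → Shape p q B
  shape-pullback iso s = record
    { ranking  = record
      { rank      = S.rank ∘ to
      ; injective = to-injective ∘ S.injective
      ; bounded   = λ x → subst (S.rank (to x) <_) (sym size≡) (S.bounded (to x))
      }
    ; respects = λ x y z → S.respects _ _ _ ∘ Equivalence.to (preserves x y z)
    ; Y        = from S.Y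
    ; Z        = from S.Z
    ; rank-Y   = trans (cong S.rank (strictlyInverseˡ S.Y)) S.rank-Y
    ; rank-Z   = trans (cong S.rank (strictlyInverseˡ S.Z)) S.rank-Z
    ; straight = λ incr notBoth → Equivalence.from (preserves _ _ _)
        (S.straight incr λ (Y∈ , Z∈) → notBoth (back Y∈ , back Z∈))
    ; bent     = λ incr Y∈ Z∈ → S.bent incr (forth Y∈) (forth Z∈) ∘ Equivalence.to (preserves _ _ _)
    }
    where
    module S = Shape s
    open _≅_ iso
    open Inverse bijection
    to-injective : Injective _≡_ _≡_ to
    to-injective eq = trans (sym (strictlyInverseʳ _)) (trans (cong from eq) (strictlyInverseʳ _))
    forth : ∀ {u x y z} → from u ∈₃ (x , y , z) → u ∈₃ (to x , to y , to z)
    forth = subst (_∈₃ _) (strictlyInverseˡ _) ∘ ∈₃-map to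
    back : ∀ {u x y z} → u ∈₃ (to x , to y , to z) → from u ∈₃ (x , y , z)
    back = ∈₃-unmap to-injective ∘ subst (_∈₃ _) (sym (strictlyInverseˡ _))

-- Rank `k` becomes `n - 1 - k`, and `Y` and `Z` trade places so that a pair with `p < q` stays in
-- this order. This symmetry folds the range of `i` in half.
shape-reverse : ∀ {p q} {V} {B : BetweennessStructure V} →
                Shape p q B → Shape (size V ∸ suc q) (size V ∸ suc p) B
shape-reverse {V = V} {B} s = record
  { ranking  = record
    { rank      = λ x → size V ∸ suc (S.rank x)
    ; injective = λ {x} {y} eq → S.injective (suc-injective
                    (∸-cancelˡ-≡ (S.bounded x) (S.bounded y) eq))
    ; bounded   = λ x → ∸-monoʳ-< (s≤s z≤n) (S.bounded x)
    }
  ; respects = λ x y z → flip ∘ S.respects x y z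
  ; Y        = S.Z
  ; Z        = S.Y
  ; rank-Y   = cong (λ k → size V ∸ suc k) S.rank-Z
  ; rank-Z   = cong (λ k → size V ∸ suc k) S.rank-Y
  ; straight = λ {x} {y} {z} (x<y , y<z) notBoth → B.P2 _ _ _
      (S.straight (unreverse y<z , unreverse x<y) λ (Y∈ , Z∈) → notBoth (mirror Z∈ , mirror Y∈))
  ; bent     = λ (x<y , y<z) Z∈ Y∈ →
      S.bent (unreverse y<z , unreverse x<y) (mirror Y∈) (mirror Z∈) ∘ B.P2 _ _ _
  }
  where
  module S = Shape s
  module B = BetweennessStructure B
  mirror : ∀ {u x y z : Carrier V} → u ∈₃ (x , y , z) → u ∈₃ (z , y , x)
  mirror = ⊆₃-intro (3rd refl) (2nd refl) (1st refl)
  unreverse : ∀ {x y} → size V ∸ suc (S.rank x) < size V ∸ suc (S.rank y) → S.rank y < S.rank x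
  unreverse lt = ≰⇒> λ x≤y → <⇒≱ lt (∸-monoʳ-≤ (size V) (s≤s x≤y))
  flip : ∀ {a b c} → Monotone a b c →
         Monotone (size V ∸ suc a) (size V ∸ suc b) (size V ∸ suc c)
  flip (inj₁ (a≤b , b≤c)) = inj₂ (∸-monoʳ-≤ (size V) (s≤s b≤c) , ∸-monoʳ-≤ (size V) (s≤s a≤b))
  flip (inj₂ (c≤b , b≤a)) = inj₁ (∸-monoʳ-≤ (size V) (s≤s b≤a) , ∸-monoʳ-≤ (size V) (s≤s c≤b))

shape-swap : ∀ {p q} {V} {B : BetweennessStructure V} → Shape p q B → Shape q p B
shape-swap s = record
  { ranking = ranking ; respects = respects
  ; Y = Z ; Z = Y ; rank-Y = rank-Z ; rank-Z = rank-Y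
  ; straight = λ incr notBoth → straight incr λ (Y∈ , Z∈) → notBoth (Z∈ , Y∈)
  ; bent = λ incr Z∈ Y∈ → bent incr Y∈ Z∈
  }
  where open Shape s

third : ∀ {A : Set} {Y Z : A} {t} → Y ≢ Z → Distinct t → Y ∈₃ t → Z ∈₃ t →
        ∃[ x ] x ≢ Y × x ≢ Z × t ≈₃ (Y , Z , x)
third Y≢Z _ (1st refl) (1st refl) = ⊥-elim (Y≢Z refl)
third Y≢Z _ (2nd refl) (2nd refl) = ⊥-elim (Y≢Z refl)
third Y≢Z _ (3rd refl) (3rd refl) = ⊥-elim (Y≢Z refl)
third _ (a≢b , a≢c , b≢c) (1st refl) (2nd refl) = _ , a≢c ∘ sym , b≢c ∘ sym , id , id
third _ (a≢b , a≢c , b≢c) (2nd refl) (1st refl) = _ , b≢c ∘ sym , a≢c ∘ sym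
  , ⊆₃-intro (2nd refl) (1st refl) (3rd refl) , ⊆₃-intro (2nd refl) (1st refl) (3rd refl)
third _ (a≢b , a≢c , b≢c) (1st refl) (3rd refl) = _ , a≢b ∘ sym , b≢c
  , ⊆₃-intro (1st refl) (3rd refl) (2nd refl) , ⊆₃-intro (1st refl) (3rd refl) (2nd refl)
third _ (a≢b , a≢c , b≢c) (3rd refl) (1st refl) = _ , b≢c , a≢b ∘ sym
  , ⊆₃-intro (2nd refl) (3rd refl) (1st refl) , ⊆₃-intro (3rd refl) (1st refl) (2nd refl)
third _ (a≢b , a≢c , b≢c) (2nd refl) (3rd refl) = _ , a≢b , a≢c
  , ⊆₃-intro (3rd refl) (1st refl) (2nd refl) , ⊆₃-intro (2nd refl) (3rd refl) (1st refl)
third _ (a≢b , a≢c , b≢c) (3rd refl) (2nd refl) = _ , a≢c , a≢b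
  , ⊆₃-intro (3rd refl) (2nd refl) (1st refl) , ⊆₃-intro (3rd refl) (2nd refl) (1st refl)

module _ {p q} {V : FiniteSet} {B : BetweennessStructure V} (s : Shape p q B) (p≢q : p ≢ q) where
  open Shape s
  open BetweennessStructure B using (Collinear)
  open Triangles B
  open Heights B rank injective respects using (_∈₃?_; sorted-β; size∸2≤coSize)

  shape⇒orderable : Orderable B
  shape⇒orderable = ranking⇒orderable {B = B} ranking respects

  private
    Y≢Z : Y ≢ Z
    Y≢Z eq = p≢q (trans (sym rank-Y) (trans (cong rank eq) rank-Z))

    triangle-contains : ∀ {t} → Triangle t → Y ∈₃ t × Z ∈₃ t
    triangle-contains {t} tri with sort rank injective t (triangle⇒distinct tri)
    ... | t′ , incr , ⊆ , ⊇ with (Y ∈₃? t′) ×-dec (Z ∈₃? t′)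
    ...   | yes (Y∈ , Z∈) = ⊆ Y∈ , ⊆ Z∈
    ...   | no notBoth    = ⊥-elim (triangle-⊆₃ ⊇ tri (inj₁ (straight incr notBoth)))

    through : ∀ {x} → x ≢ Y → x ≢ Z → Triangle (Y , Z , x)
    through {x} x≢Y x≢Z with sort rank injective (Y , Z , x) (Y≢Z , x≢Y ∘ sym , x≢Z ∘ sym)
    ... | t′ , incr , ⊆ , ⊇ =
      triangle-⊆₃ ⊆ (bent incr (⊇ (1st refl)) (⊇ (2nd refl)) ∘ sorted-β incr)

    apex : ∀ i → ∃[ x ] x ≢ Y × x ≢ Z × nth i ≈₃ (Y , Z , x)
    apex i = third Y≢Z (triangle⇒distinct (nth-triangle i))
               (proj₁ (triangle-contains (nth-triangle i)))
               (proj₂ (triangle-contains (nth-triangle i)))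

    -- Triangles through `Y` and `Z` are told apart by their third points, so these together with
    -- `Y` and `Z` inject `2 + coSize B` indices into the ground set.
    point′ : Fin (2 + coSize B) → Carrier V
    point′ zero          = Y
    point′ (suc zero)    = Z
    point′ (suc (suc i)) = proj₁ (apex i)

    point′-injective : Injective _≡_ _≡_ point′
    point′-injective {zero}        {zero}        _  = refl
    point′-injective {zero}        {suc zero}    eq = ⊥-elim (Y≢Z eq)
    point′-injective {zero}        {suc (suc j)} eq = ⊥-elim (proj₁ (proj₂ (apex j)) (sym eq))
    point′-injective {suc zero}    {zero}        eq = ⊥-elim (Y≢Z (sym eq))
    point′-injective {suc zero}    {suc zero}    _  = refl
    point′-injective {suc zero}    {suc (suc j)} eq = ⊥-elim (proj₁ (proj₂ (proj₂ (apex j))) (sym eq))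
    point′-injective {suc (suc i)} {zero}        eq = ⊥-elim (proj₁ (proj₂ (apex i)) eq)
    point′-injective {suc (suc i)} {suc zero}    eq = ⊥-elim (proj₁ (proj₂ (proj₂ (apex i))) eq)
    point′-injective {suc (suc i)} {suc (suc j)} eq = cong (λ k → suc (suc k)) 
      (nth-injective (same eq (proj₂ (proj₂ (proj₂ (apex i)))) (proj₂ (proj₂ (proj₂ (apex j))))))
      where
      same : ∀ {x x′ : Carrier V} {t t′} → x ≡ x′ →
             t ≈₃ (Y , Z , x) → t′ ≈₃ (Y , Z , x′) → t ≈₃ t′
      same refl (⊆ , ⊇) (⊆′ , ⊇′) = ⊇′ ∘ ⊆ , ⊇ ∘ ⊆′

  -- The upper bound is the injectivity of `point′`. For the lower bound, `3 ≤ size V` supplies a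
  -- point beyond `Y` and `Z`, hence a triangle from which spokes can start.
  shape-coSize : 3 ≤ size V → coSize B ≡ size V ∸ 2
  shape-coSize 3≤ = ≤-antisym
      (∸-monoˡ-≤ 2 (Finₚ.injective⇒≤ {f = Inverse.to (enumeration V) ∘ point′}
        (point′-injective ∘ to-injective)))
      (size∸2≤coSize (through (proj₁ (proj₂ (proj₂ rest)) i) (proj₂ (proj₂ (proj₂ rest)) i)))
    where
    rest = others Y≢Z
    i : Fin (size V ∸ 2)
    i = fromℕ< (∸-monoˡ-≤ 2 3≤)
    open Inverse (enumeration V)
    to-injective : Injective _≡_ _≡_ to
    to-injective eq = trans (sym (strictlyInverseʳ _)) (trans (cong from eq) (strictlyInverseʳ _))

orderable⇒size∸2≤coSize : ∀ {V} {B : BetweennessStructure V} → Orderable B → 0 < coSize B →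
                          size V ∸ 2 ≤ coSize B
orderable⇒size∸2≤coSize {B = B} orderable 0< with orderable⇒ranking {B = B} orderable
... | r , respects = Heights.size∸2≤coSize B (Ranking.rank r) (Ranking.injective r) respects
                       (proj₂ (Triangles.triangle? B 0<))

-- The position of the common pair in the order

module _ {V : FiniteSet} {B : BetweennessStructure V} where
  open BetweennessStructure B hiding (coSize)
  open Triangles B

  module _ {p q} (s : Shape p q B) where
    open Shape s

    private
      ∉-above : ∀ {u a b c} → rank a < rank u → rank b < rank u → rank c < rank u →
                ¬ u ∈₃ (a , b , c)
      ∉-above a< b< c< (1st refl) = <-irrefl refl a<
      ∉-above a< b< c< (2nd refl) = <-irrefl refl b<
      ∉-above a< b< c< (3rd refl) = <-irrefl refl c<

      ∉-below : ∀ {u a b c} → rank u < rank a → rank u < rank b → rank u < rank c →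
                ¬ u ∈₃ (a , b , c)
      ∉-below <a <b <c (1st refl) = <-irrefl refl <a
      ∉-below <a <b <c (2nd refl) = <-irrefl refl <b
      ∉-below <a <b <c (3rd refl) = <-irrefl refl <c

    -- Both `u x Z` and `u Y x` miss one point of the pair, so they are straight, and `P4` yields
    -- `β Y x Z`; but this triple contains the pair and is bent.
    not-outside-below : ∀ {u x} → rank u < rank Y → rank Y < rank x → rank x < rank Z → ⊥
    not-outside-below {u} {x} u<Y Y<x x<Z =
      bent (Y<x , x<Z) (1st refl) (3rd refl) (proj₂ (P4 u x Z Y
        (straight (<-trans u<Y Y<x , x<Z) λ (Y∈ , _) → Y∉ Y∈)
        (straight (u<Y , Y<x) (∉-above (<-trans u<Y (<-trans Y<x x<Z)) (<-trans Y<x x<Z) x<Z ∘ proj₂))))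
      where
      Y∉ : ¬ Y ∈₃ (u , x , Z)
      Y∉ (1st refl) = <-irrefl refl u<Y
      Y∉ (2nd refl) = <-irrefl refl Y<x
      Y∉ (3rd eq)   = <-irrefl (cong rank eq) (<-trans Y<x x<Z)

    not-outside-above : ∀ {u x} → rank Y < rank x → rank x < rank Z → rank Z < rank u → ⊥
    not-outside-above {u} {x} Y<x x<Z Z<u =
      bent (Y<x , x<Z) (1st refl) (3rd refl) (P2 _ _ _ (proj₂ (P4 u x Y Z
        (P2 _ _ _ (straight (Y<x , <-trans x<Z Z<u) λ (_ , Z∈) → Z∉ Z∈))
        (P2 _ _ _ (straight (x<Z , Z<u)
          (∉-below Y<x (<-trans Y<x x<Z) (<-trans Y<x (<-trans x<Z Z<u)) ∘ proj₁))))))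
      where
      Z∉ : ¬ Z ∈₃ (Y , x , u)
      Z∉ (1st eq)   = <-irrefl (sym (cong rank eq)) (<-trans Y<x x<Z)
      Z∉ (2nd refl) = <-irrefl refl x<Z
      Z∉ (3rd refl) = <-irrefl refl Z<u

    -- If the pair is not consecutive, the point at rank `p + 1` lies strictly between `Y` and `Z`,
    -- and this rules out any point below `Y` or above `Z`.
    shape-position : p < q → q ≡ suc p ⊎ (p ≡ 0 × suc q ≡ size V)
    shape-position p<q with m≤n⇒m<n∨m≡n p<q
    ... | inj₂ eq    = inj₁ (sym eq)
    ... | inj₁ p+1<q = inj₂ (n≤0⇒n≡0 (≮⇒≥ 0≮p) , ≤-antisym q<n (≮⇒≥ q+1≮n))
      where
      q<n : q < size V
      q<n = subst (_< size V) rank-Z (bounded Z)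
      p+1<n : suc p < size V
      p+1<n = <-trans p+1<q q<n
      x : Carrier V
      x = at p+1<n
      Y<x : rank Y < rank x
      Y<x = subst₂ _<_ (sym rank-Y) (sym (rank-at p+1<n)) ≤-refl
      x<Z : rank x < rank Z
      x<Z = subst₂ _<_ (sym (rank-at p+1<n)) (sym rank-Z) p+1<q
      0≮p : ¬ 0 < p
      0≮p 0<p = not-outside-below {at p-1<n}
        (subst₂ _<_ (sym (rank-at p-1<n)) (sym rank-Y) (∸-monoʳ-< (s≤s z≤n) 0<p)) Y<x x<Z
        where
        p-1<n : p ∸ 1 < size V
        p-1<n = ≤-<-trans (m∸n≤m p 1) (<-trans p<q q<n)
      q+1≮n : ¬ suc q < size V
      q+1≮n q+1<n = not-outside-above {at q+1<n} Y<x x<Z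
        (subst₂ _<_ (sym rank-Z) (sym (rank-at q+1<n)) ≤-refl)

  orderable⇒shape : Orderable B → 0 < coSize B → coSize B ≤ size V ∸ 2 →
                    ∃₂ λ p q → p < q × Shape p q B
  orderable⇒shape orderable 0< minimal with orderable⇒ranking {B = B} orderable
  ... | r , respects
    with Heights.Extremal.common-pair B (Ranking.rank r) (Ranking.injective r) respects
           minimal (proj₂ (triangle? 0<))
  ...   | Y , Z , Y≢Z , through = ordered (compareBy (Ranking.rank r) (Ranking.injective r) Y≢Z)
    where
    open Ranking r using (rank; injective)
    open Heights B rank injective respects
    open Extremal minimal
    s : Shape (rank Y) (rank Z) B
    s = record
      { ranking = r ; respects = respects
      ; Y = Y ; Z = Z ; rank-Y = refl ; rank-Z = refl
      -- A non-collinear triple would contain both `Y` and `Z`; decidability of collinearity removes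
      -- the resulting double negation.
      ; straight = λ {x} {y} {z} incr notBoth → sorted-β incr
          (decidable-stable (collinear? x y z) (notBoth ∘ contains-pair Y≢Z through))
      ; bent = λ incr Y∈ Z∈ xyz → bent′ (third Y≢Z (increasing⇒distinct rank incr) Y∈ Z∈) xyz
      }
      where
      bent′ : ∀ {x y z} → (∃[ u ] u ≢ Y × u ≢ Z × (x , y , z) ≈₃ (Y , Z , u)) → ¬ β x y z
      bent′ (u , u≢Y , u≢Z , _ , ⊇) xyz = triangle-⊆₃ ⊇ (through u≢Y u≢Z) (inj₁ xyz)
    ordered : rank Y < rank Z ⊎ rank Z < rank Y → ∃₂ λ p q → p < q × Shape p q B
    ordered (inj₁ Y<Z) = _ , _ , Y<Z , s
    ordered (inj₂ Z<Y) = _ , _ , Z<Y , shape-swap s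

-- Distances in graphs with levels

-- Truncated differences still obey the triangle inequality. Truncation is needed for S, whose long
-- edge is one shorter than the difference of levels between its ends.
⊓-subadditive : ∀ a b m → (a + b) ⊓ m ≤ a ⊓ m + b ⊓ m
⊓-subadditive a b m with ≤-total a m | ≤-total b m
... | inj₂ m≤a | _ rewrite m≥n⇒m⊓n≡n m≤a = ≤-trans (m⊓n≤n (a + b) m) (m≤m+n m (b ⊓ m))
... | inj₁ _   | inj₂ m≤b rewrite m≥n⇒m⊓n≡n m≤b =
  ≤-trans (m⊓n≤n (a + b) m) (m≤n+m m (a ⊓ m))
... | inj₁ a≤m | inj₁ b≤m rewrite m≤n⇒m⊓n≡m a≤m | m≤n⇒m⊓n≡m b≤m = m⊓n≤m (a + b) m

between⇒monotone : ∀ a b c → ∣ a - c ∣ ≡ ∣ a - b ∣ + ∣ b - c ∣ → Monotone a b c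
between⇒monotone zero    b       c    eq = inj₁ (z≤n , subst (b ≤_) (sym eq) (m≤m+n b ∣ b - c ∣))
between⇒monotone (suc a) zero    zero eq = inj₂ (z≤n , z≤n)
between⇒monotone (suc a) zero (suc c) eq = ⊥-elim (<⇒≢ (begin-strict
  ∣ a - c ∣      ≤⟨ ∣m-n∣≤m⊔n a c ⟩
  a ⊔ c          ≤⟨ m⊔n≤m+n a c ⟩
  a + c          <⟨ +-mono-< (n<1+n a) (n<1+n c) ⟩
  suc a + suc c  ∎) eq)
  where open ≤-Reasoning
between⇒monotone (suc a) (suc b) zero eq = inj₂ (z≤n , (begin
  suc b                  ≤⟨ m≤n+m (suc b) ∣ a - b ∣ ⟩
  ∣ a - b ∣ + suc b  ≡⟨ eq ⟨
  suc a                  ∎))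
  where open ≤-Reasoning
between⇒monotone (suc a) (suc b) (suc c) eq with between⇒monotone a b c eq
... | inj₁ (a≤b , b≤c) = inj₁ (s≤s a≤b , s≤s b≤c)
... | inj₂ (c≤b , b≤a) = inj₂ (s≤s c≤b , s≤s b≤a)

increasing⇒between : ∀ {a b c} → a ≤ b → b ≤ c → ∣ a - c ∣ ≡ ∣ a - b ∣ + ∣ b - c ∣
increasing⇒between {b = b} z≤n b≤c =
  sym (trans (cong (b +_) (m≤n⇒∣m-n∣≡n∸m b≤c)) (m+[n∸m]≡n b≤c))
increasing⇒between (s≤s a≤b) (s≤s b≤c) = increasing⇒between a≤b b≤c

-- In a collinear triple one side is the sum of the other two, so the perimeter is twice that side.
-- For y, z and a path vertex x, the perimeter is 1 + 2 d(z, x) in Q and R, and 2(n - 2) + 1 in S.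
odd-perimeter⇒triangle : ∀ {V} (G : Graph V) {x y z} k →
  Graph.d G x y + Graph.d G y z + Graph.d G x z ≡ suc (2 * k) →
  Triangles.Triangle (induced G) (x , y , z)
odd-perimeter⇒triangle {V} G {x} {y} {z} k odd = λ where
    (inj₁ p)                             → xz p
    (inj₂ (inj₁ p))                      → xy (trans p (cong (d x z +_) (d-sym z y)))
    (inj₂ (inj₂ (inj₁ p)))               → yz (trans p (cong (_+ d x z) (d-sym y x)))
    (inj₂ (inj₂ (inj₂ (inj₁ p))))        → xy (trans (d-sym x y) (trans p (trans
                                             (+-comm (d y z) (d z x)) (cong (_+ d y z) (d-sym z x)))))
    (inj₂ (inj₂ (inj₂ (inj₂ (inj₁ p))))) → yz (trans (d-sym y z) (trans p (trans
                                             (+-comm (d z x) (d x y)) (cong (d x y +_) (d-sym z x)))))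
    (inj₂ (inj₂ (inj₂ (inj₂ (inj₂ p))))) → xz (trans (d-sym x z) (trans p (trans
                                             (+-comm (d z y) (d y x)) (cong₂ _+_ (d-sym y x) (d-sym z y)))))
  where
  open Graph G
  even : ∀ {a} → d x y + d y z + d x z ≡ 2 * a → ⊥
  even {a} eq = even≢odd a k (trans (sym eq) odd)
  double₁ : ∀ a b → a + b + (a + b) ≡ 2 * (a + b)
  double₁ = solve-∀
  double₂ : ∀ a b → a + b + b + a ≡ 2 * (a + b)
  double₂ = solve-∀
  double₃ : ∀ a b → a + (a + b) + b ≡ 2 * (a + b)
  double₃ = solve-∀
  xz : d x z ≡ d x y + d y z → ⊥
  xz p = even {d x y + d y z} (trans (cong (d x y + d y z +_) p) (double₁ (d x y) (d y z)))
  xy : d x y ≡ d x z + d y z → ⊥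
  xy p = even {d x z + d y z} (trans (cong (λ a → a + d y z + d x z) p) (double₂ (d x z) (d y z)))
  yz : d y z ≡ d x y + d x z → ⊥
  yz p = even {d x y + d x z} (trans (cong (λ a → d x y + a + d x z) p) (double₃ (d x y) (d x z)))

Pair : ∀ {n} → Vertex n → Vertex n → Set
Pair u v = (u ≡ vy × v ≡ vz) ⊎ (u ≡ vz × v ≡ vy)

-- Consecutive levels are completely joined by edges of weight 1, and no edge is
-- shorter than the truncated difference of the levels of its ends; so distances
-- are differences of levels, except possibly between y and z.
module Levels {n : ℕ} (G : Graph (vertexSet n)) (r : Ranking (vertexSet n))
  (level : Vertex n → ℕ) (top M : ℕ)
  (level≤top : ∀ v → level v ≤ top)
  (onto : ∀ {k} → k ≤ top → ∃[ v ] level v ≡ k)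
  (link : ∀ u v → level v ≡ suc (level u) → Graph.w G u v ≡ 1)
  (edge : ∀ u v → Graph.Adjacent G u v → ∣ level u - level v ∣ ⊓ M ≤ Graph.w G u v)
  (near : ∀ u v → u ≢ v → ¬ Pair u v → level u ≢ level v × ∣ level u - level v ∣ ≤ M)
  (compatible : ∀ u v → Ranking.rank r u < Ranking.rank r v → level u ≤ level v)
  where
  open Graph G
  open Ranking r using (rank; injective)

  private
    D : Vertex n → Vertex n → ℕ
    D u v = ∣ level u - level v ∣

  D⊓M≤len : ∀ {u v} (p : Walk u v) → D u v ⊓ M ≤ len p
  D⊓M≤len {u} nil rewrite ∣n-n∣≡0 (level u) = z≤n
  D⊓M≤len {u} {v} (step {v = t} e p) = begin
    D u v ⊓ M              ≤⟨ ⊓-monoˡ-≤ M (∣-∣-triangle (level u) (level t) (level v)) ⟩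
    (D u t + D t v) ⊓ M    ≤⟨ ⊓-subadditive (D u t) (D t v) M ⟩
    D u t ⊓ M + D t v ⊓ M  ≤⟨ +-mono-≤ (edge u t e) (D⊓M≤len p) ⟩
    w u t + len p          ∎
    where open ≤-Reasoning

  D⊓M≤d : ∀ u v → D u v ⊓ M ≤ d u v
  D⊓M≤d u v with d-walk u v
  ... | p , eq = subst (D u v ⊓ M ≤_) eq (D⊓M≤len p)

  private
    adjacent : ∀ u v → level v ≡ suc (level u) → Adjacent u v
    adjacent u v eq = subst (0 <_) (sym (link u v eq)) (s≤s z≤n)

    -- `onto` supplies a vertex on each intermediate level, and vertices on consecutive levels are
    -- joined by `link`.
    climb : ∀ k u v → level v ≡ suc k + level u → Σ[ p ∈ Walk u v ] len p ≡ suc k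
    climb zero    u v eq = step (adjacent u v eq) nil , trans (+-identityʳ (w u v)) (link u v eq)
    climb (suc k) u v eq with onto {suc (level u)}
      (≤-trans (s≤s (m≤n+m (level u) (suc k))) (subst (_≤ top) eq (level≤top v)))
    ... | t , t≡ with climb k t v (trans eq (trans (sym (+-suc (suc k) (level u)))
                                                    (cong (suc k +_) (sym t≡))))
    ...   | p , len≡ = step (adjacent u t t≡) p , cong₂ _+_ (link u t t≡) len≡

    d≤D : ∀ u v → level u < level v → d u v ≤ D u v
    d≤D u v u<v with climb (level v ∸ suc (level u)) u v
      (trans (sym (m∸n+n≡m u<v)) (+-suc (level v ∸ suc (level u)) (level u)))
    ... | p , len≡ = ≤-trans (d≤len p) (≤-reflexive (trans len≡
      (trans (sym (+-∸-assoc 1 u<v)) (sym (m≤n⇒∣m-n∣≡n∸m (<⇒≤ u<v))))))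

  -- Off the pair the level difference is at most `M`, so the truncated lower bound is the full one.
  -- Distinct levels allow a climb in one of the two directions, which gives the upper bound.
  d≡D : ∀ u v → ¬ Pair u v → d u v ≡ D u v
  d≡D u v ¬pair with FiniteSet._≟ᵥ_ (vertexSet n) u v
  ... | yes refl = trans (d-refl u) (sym (∣n-n∣≡0 (level u)))
  ... | no u≢v with near u v u≢v ¬pair
  ...   | level≢ , D≤M = ≤-antisym upper
            (subst (_≤ d u v) (m≤n⇒m⊓n≡m D≤M) (D⊓M≤d u v))
    where
    upper : d u v ≤ D u v
    upper with <-cmp (level u) (level v)
    ... | tri< u<v _ _ = d≤D u v u<v
    ... | tri≈ _ u≡v _ = ⊥-elim (level≢ u≡v)
    ... | tri> _ _ v<u = subst₂ _≤_ (d-sym v u) (∣-∣-comm (level v) (level u)) (d≤D v u v<u)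

  module _ (triangle : ∀ i → Triangles.Triangle (induced G) (vy , vz , vx i)) where
    open BetweennessStructure (induced G)
    open Triangles (induced G)

    private
      vy≢vz : _≢_ {A = Vertex n} vy vz
      vy≢vz ()

      with-pair : ∀ {x y z : Vertex n} → Distinct (x , y , z) → vy ∈₃ (x , y , z) → vz ∈₃ (x , y , z) →
                  ¬ β x y z
      with-pair distinct y∈ z∈ xyz with third vy≢vz distinct y∈ z∈
      ... | vx i , _ , _ , _ , ⊇ = triangle-⊆₃ ⊇ (triangle i) (inj₁ xyz)
      ... | vy , ≢vy , _ = ≢vy refl
      ... | vz , _ , ≢vz , _ = ≢vz refl

      pairs : ∀ {u v : Vertex n} {t} → u ∈₃ t → v ∈₃ t → Pair u v → vy ∈₃ t × vz ∈₃ t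
      pairs u∈ v∈ (inj₁ (refl , refl)) = u∈ , v∈
      pairs u∈ v∈ (inj₂ (refl , refl)) = v∈ , u∈

      -- Only y and z can share a level, so on all other pairs of distinct points levels and ranks
      -- induce the same order.
      rank-monotone : ∀ {u v} → u ≢ v → ¬ Pair u v → level u ≤ level v → rank u ≤ rank v
      rank-monotone {u} {v} u≢v ¬pair u≤v = ≮⇒≥ λ v<u →
        proj₁ (near u v u≢v ¬pair) (≤-antisym u≤v (compatible v u v<u))

      swap : ∀ {u v : Vertex n} → ¬ Pair u v → ¬ Pair v u
      swap ¬pair (inj₁ (eq , eq′)) = ¬pair (inj₂ (eq′ , eq))
      swap ¬pair (inj₂ (eq , eq′)) = ¬pair (inj₁ (eq′ , eq))

      without-pair : ∀ {x y z} → x ≢ y → y ≢ z → ¬ (vy ∈₃ (x , y , z) × vz ∈₃ (x , y , z)) →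
                     β x y z → Monotone (rank x) (rank y) (rank z)
      without-pair {x} {y} {z} x≢y y≢z notBoth xyz
        with between⇒monotone (level x) (level y) (level z)
               (trans (sym (d≡D x z (notBoth ∘ pairs (1st refl) (3rd refl))))
                 (trans xyz (cong₂ _+_ (d≡D x y (notBoth ∘ pairs (1st refl) (2nd refl)))
                                       (d≡D y z (notBoth ∘ pairs (2nd refl) (3rd refl))))))
      ... | inj₁ (x≤y , y≤z) =
              inj₁ ( rank-monotone x≢y (notBoth ∘ pairs (1st refl) (2nd refl)) x≤y
                   , rank-monotone y≢z (notBoth ∘ pairs (2nd refl) (3rd refl)) y≤z )
      ... | inj₂ (z≤y , y≤x) =
              inj₂ ( rank-monotone (y≢z ∘ sym) (swap (notBoth ∘ pairs (2nd refl) (3rd refl))) z≤y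
                   , rank-monotone (x≢y ∘ sym) (swap (notBoth ∘ pairs (1st refl) (2nd refl))) y≤x )

      -- Degenerate triples are monotone in any case, those with both y and z are triangles, and on
      -- the rest distances are those of points on a line.
      respects : Respects r (induced G)
      respects x y z xyz with FiniteSet._≟ᵥ_ (vertexSet n) x y | FiniteSet._≟ᵥ_ (vertexSet n) y z
      ... | yes refl | _ = [ inj₁ ∘ (≤-refl ,_) , inj₂ ∘ (_, ≤-refl) ]′ (≤-total (rank x) (rank z))
      ... | no _ | yes refl = [ inj₁ ∘ (_, ≤-refl) , inj₂ ∘ (≤-refl ,_) ]′ (≤-total (rank x) (rank y))
      ... | no x≢y | no y≢z = without-pair x≢y y≢z
              (λ (y∈ , z∈) → with-pair (x≢y , x≢z , y≢z) y∈ z∈ xyz) xyz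
        where
        x≢z : x ≢ z
        x≢z refl = x≢y (β-xyx⇒≡ xyz)

    levels⇒shape : Shape (rank vy) (rank vz) (induced G)
    levels⇒shape = record
      { ranking = r ; respects = respects
      ; Y = vy ; Z = vz ; rank-Y = refl ; rank-Z = refl
      ; straight = λ {x} {y} {z} (x<y , y<z) notBoth →
          trans (d≡D x z (notBoth ∘ pairs (1st refl) (3rd refl)))
            (trans (increasing⇒between (compatible x y x<y) (compatible y z y<z))
              (sym (cong₂ _+_ (d≡D x y (notBoth ∘ pairs (1st refl) (2nd refl)))
                              (d≡D y z (notBoth ∘ pairs (2nd refl) (3rd refl))))))
      ; bent = λ incr → with-pair (increasing⇒distinct rank incr)
      }

-- The graphs Q and R

-- skip c lists the naturals other than c; applied twice it leaves out c and c + 1,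
-- the positions of y and z in the order x₁ … x_c y z x_(c+1) … .
skip : ℕ → ℕ → ℕ
skip zero    k       = suc k
skip (suc c) zero    = zero
skip (suc c) (suc k) = suc (skip c k)

skip-injective : ∀ c {j k} → skip c j ≡ skip c k → j ≡ k
skip-injective zero    eq                   = suc-injective eq
skip-injective (suc c) {zero}  {zero}  _  = refl
skip-injective (suc c) {suc j} {suc k} eq = cong suc (skip-injective c (suc-injective eq))

skip≢ : ∀ c k → skip c k ≢ c
skip≢ (suc c) (suc k) eq = skip≢ c k (suc-injective eq)

skip-skip≢suc : ∀ c k → skip c (skip c k) ≢ suc c
skip-skip≢suc (suc c) (suc k) eq = skip-skip≢suc c k (suc-injective eq)

skip≤suc : ∀ c k → skip c k ≤ suc k
skip≤suc zero    k       = ≤-refl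
skip≤suc (suc c) zero    = z≤n
skip≤suc (suc c) (suc k) = s≤s (skip≤suc c k)

≤skip : ∀ c k → k ≤ skip c k
≤skip zero    k       = n≤1+n k
≤skip (suc c) zero    = z≤n
≤skip (suc c) (suc k) = s≤s (≤skip c k)

skip-mono-≤ : ∀ c {j k} → j ≤ k → skip c j ≤ skip c k
skip-mono-≤ zero    j≤k       = s≤s j≤k
skip-mono-≤ (suc c) z≤n       = z≤n
skip-mono-≤ (suc c) (s≤s j≤k) = s≤s (skip-mono-≤ c j≤k)

skip-reflects-≥ : ∀ c k → c ≤ skip c k → c ≤ k
skip-reflects-≥ zero    k       _        = z≤n
skip-reflects-≥ (suc c) (suc k) (s≤s le) = s≤s (skip-reflects-≥ c k le)

unskip : ∀ {c k m} → c ≤ m → k ≤ m → k ≢ c → ∃[ j ] j < m × skip c j ≡ k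
unskip {zero}  {zero}          _         _         k≢c = ⊥-elim (k≢c refl)
unskip {zero}  {suc k}         _         k<m       _   = k , k<m , refl
unskip {suc c} {zero}          (s≤s _)   _         _   = 0 , s≤s z≤n , refl
unskip {suc c} {suc k} {suc m} (s≤s c≤m) (s≤s k≤m) k≢c with unskip c≤m k≤m (k≢c ∘ cong suc)
... | j , j<m , eq = suc j , s≤s j<m , cong suc eq

-- The weight that `Rweights` gives to the edges from `x_a` to each of y and z.
touches : ℕ → ℕ → ℕ
touches c a = 𝟙 ((a ≡ᵇ c) ∨ (a ≡ᵇ suc c))

-- The vertex `x_(a+1)` sits on level `skip c a`. The deleted edge would join levels `c - 1` and
-- `c + 1`, on either side of the twins, so it never links consecutive levels.
skip-pathEdge : ∀ c a b → skip c b ≡ suc (skip c a) → pathEdgeWithout c (suc a) (suc b) ≡ 1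
skip-pathEdge zero a _ refl
  rewrite trans (∣-∣-comm a (suc a)) (∣1+a-a∣≡1 a) = refl
skip-pathEdge (suc zero)    zero    zero    ()
skip-pathEdge (suc (suc c)) zero    (suc zero)    eq = refl
skip-pathEdge (suc (suc c)) zero    (suc (suc b)) ()
skip-pathEdge (suc zero)    zero    (suc b)       ()
skip-pathEdge (suc c)       (suc a) (suc b)       eq = skip-pathEdge c a b (suc-injective eq)

pathEdge-skip : ∀ c a b → 0 < pathEdgeWithout c (suc a) (suc b) → ∣ skip c a - skip c b ∣ ≤ 1
pathEdge-skip zero    a       b       e with ∣ a - b ∣ ≡ᵇ 1 in eq
... | true = ≤-reflexive (≡ᵇ⇒≡ _ 1 (subst T (sym eq) _))
pathEdge-skip (suc c)       zero    zero       e = z≤n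
pathEdge-skip (suc (suc c)) zero    (suc zero) e = ≤-refl
pathEdge-skip (suc (suc c)) (suc zero) zero    e = ≤-refl
pathEdge-skip (suc zero)    (suc zero)    zero ()
pathEdge-skip (suc zero)    (suc (suc a)) zero ()
pathEdge-skip (suc c)       (suc a) (suc b)    e = pathEdge-skip c a b e

skip-touches-below : ∀ c a → c ≡ suc (skip c a) → touches c (suc a) ≡ 1
skip-touches-below (suc zero)    zero    eq = refl
skip-touches-below (suc c)       (suc a) eq = skip-touches-below c a (suc-injective eq)

skip-touches-above : ∀ c a → skip c a ≡ suc c → touches c (suc a) ≡ 1
skip-touches-above zero    zero    eq = refl
skip-touches-above (suc c) (suc a) eq = skip-touches-above c a (suc-injective eq)

touches-skip : ∀ c a → 0 < touches c (suc a) → ∣ skip c a - c ∣ ≤ 1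
touches-skip zero          zero    e = ≤-refl
touches-skip (suc zero)    zero    e = ≤-refl
touches-skip (suc (suc c)) zero    ()
touches-skip (suc c)       (suc a) e = touches-skip c a e

∣m-n∣≤o : ∀ {m n o} → m ≤ o → n ≤ o → ∣ m - n ∣ ≤ o
∣m-n∣≤o {m} {n} m≤o n≤o = ≤-trans (∣m-n∣≤m⊔n m n) (⊔-lub m≤o n≤o)

-- Rweights n 0 are the weights of Q, so this covers Q (c = 0) and R together.
module Twins {n : ℕ} {c : ℕ} (c≤ : c ≤ n ∸ 2) (G : Graph (vertexSet n))
  (weights≡ : ∀ u v → Graph.w G u v ≡ Rweights n c u v) where
  open Graph G

  private
    m : ℕ
    m = n ∸ 2

    ranks : Vertex n → ℕ
    ranks (vx k) = skip c (skip c (toℕ k))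
    ranks vy     = c
    ranks vz     = suc c

    -- The vertices y and z have the same neighbours on the path, so they share level `c`, and the
    -- path has to skip only this one.
    level : Vertex n → ℕ
    level (vx k) = skip c (toℕ k)
    level vy     = c
    level vz     = c

    ranks-injective : ∀ u v → ranks u ≡ ranks v → u ≡ v
    ranks-injective (vx j) (vx k) eq =
      cong vx (Finₚ.toℕ-injective (skip-injective c (skip-injective c eq)))
    ranks-injective (vx j) vy     eq = ⊥-elim (skip≢ c _ eq)
    ranks-injective (vx j) vz     eq = ⊥-elim (skip-skip≢suc c (toℕ j) eq)
    ranks-injective vy     (vx k) eq = ⊥-elim (skip≢ c _ (sym eq))
    ranks-injective vy     vy     eq = refl
    ranks-injective vy     vz     eq = ⊥-elim (1+n≢n (sym eq))
    ranks-injective vz     (vx k) eq = ⊥-elim (skip-skip≢suc c (toℕ k) (sym eq))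
    ranks-injective vz     vy     eq = ⊥-elim (1+n≢n eq)
    ranks-injective vz     vz     eq = refl

    level≤m : ∀ v → level v ≤ m
    level≤m (vx k) = ≤-trans (skip≤suc c (toℕ k)) (Finₚ.toℕ<n k)
    level≤m vy     = c≤
    level≤m vz     = c≤

    ranking : Ranking (vertexSet n)
    ranking = record
      { rank      = ranks
      ; injective = ranks-injective _ _
      ; bounded   = λ { (vx k) → s≤s (≤-trans (skip≤suc c _) (s≤s (level≤m (vx k))))
                      ; vy     → s≤s (m≤n⇒m≤1+n c≤)
                      ; vz     → s≤s (s≤s c≤) }
      }

    onto : ∀ {k} → k ≤ m → ∃[ v ] level v ≡ k
    onto {k} k≤m with k ≟ c
    ... | yes refl = vy , refl
    ... | no k≢c with unskip c≤ k≤m k≢c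
    ...   | j , j<m , eq = vx (fromℕ< j<m) , trans (cong (skip c) (Finₚ.toℕ-fromℕ< j<m)) eq

    R-link : ∀ u v → level v ≡ suc (level u) → Rweights n c u v ≡ 1
    R-link (vx j) (vx k) eq = skip-pathEdge c (toℕ j) (toℕ k) eq
    R-link (vx j) vy     eq = skip-touches-below c (toℕ j) eq
    R-link (vx j) vz     eq = skip-touches-below c (toℕ j) eq
    R-link vy     (vx k) eq = skip-touches-above c (toℕ k) eq
    R-link vz     (vx k) eq = skip-touches-above c (toℕ k) eq
    R-link vy     vy     eq = ⊥-elim (1+n≢n (sym eq))
    R-link vy     vz     eq = ⊥-elim (1+n≢n (sym eq))
    R-link vz     vy     eq = ⊥-elim (1+n≢n (sym eq))
    R-link vz     vz     eq = ⊥-elim (1+n≢n (sym eq))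

    R-edge : ∀ u v → 0 < Rweights n c u v → ∣ level u - level v ∣ ≤ 1
    R-edge (vx j) (vx k) e = pathEdge-skip c (toℕ j) (toℕ k) e
    R-edge (vx j) vy     e = touches-skip c (toℕ j) e
    R-edge (vx j) vz     e = touches-skip c (toℕ j) e
    R-edge vy     (vx k) e =
      subst (_≤ 1) (∣-∣-comm (skip c (toℕ k)) c) (touches-skip c (toℕ k) e)
    R-edge vz     (vx k) e =
      subst (_≤ 1) (∣-∣-comm (skip c (toℕ k)) c) (touches-skip c (toℕ k) e)
    R-edge vy     vz     e = subst (_≤ 1) (sym (∣n-n∣≡0 c)) z≤n
    R-edge vz     vy     e = subst (_≤ 1) (sym (∣n-n∣≡0 c)) z≤n

    edge : ∀ u v → Adjacent u v → ∣ level u - level v ∣ ⊓ m ≤ w u v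
    edge u v e = ≤-trans (m⊓n≤m _ m) (≤-trans (R-edge u v (subst (0 <_) (weights≡ u v) e)) e)

    level≢ : ∀ u v → u ≢ v → ¬ Pair u v → level u ≢ level v
    level≢ (vx j) (vx k) u≢v _ eq = u≢v (cong vx (Finₚ.toℕ-injective (skip-injective c eq)))
    level≢ (vx j) vy     _ _ eq = skip≢ c _ eq
    level≢ (vx j) vz     _ _ eq = skip≢ c _ eq
    level≢ vy     (vx k) _ _ eq = skip≢ c _ (sym eq)
    level≢ vz     (vx k) _ _ eq = skip≢ c _ (sym eq)
    level≢ vy     vy     u≢v _ _ = u≢v refl
    level≢ vz     vz     u≢v _ _ = u≢v refl
    level≢ vy     vz     _ ¬pair _ = ¬pair (inj₁ (refl , refl))
    level≢ vz     vy     _ ¬pair _ = ¬pair (inj₂ (refl , refl))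

    compatible : ∀ u v → ranks u < ranks v → level u ≤ level v
    compatible (vx j) (vx k) lt =
      ≮⇒≥ λ k<j → <⇒≱ lt (skip-mono-≤ c (<⇒≤ k<j))
    compatible (vx j) vy     lt = ≤-trans (≤skip c _) (<⇒≤ lt)
    compatible (vx j) vz     lt = ≤-trans (≤skip c _) (s≤s⁻¹ lt)
    compatible vy     (vx k) lt = skip-reflects-≥ c _ (<⇒≤ lt)
    compatible vz     (vx k) lt = skip-reflects-≥ c _ (<⇒≤ (<⇒≤ lt))
    compatible vy     vy     lt = ≤-refl
    compatible vy     vz     lt = ≤-refl
    compatible vz     vy     lt = ≤-refl
    compatible vz     vz     lt = ≤-refl

    -- All levels lie between `0` and `m`, so truncation at `m` changes no level difference here.
    open Levels G ranking level m m level≤m onto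
      (λ u v → trans (weights≡ u v) ∘ R-link u v) edge
      (λ u v u≢v ¬pair → level≢ u v u≢v ¬pair , ∣m-n∣≤o (level≤m u) (level≤m v)) compatible

    d-yz : d vy vz ≡ 1
    d-yz = ≤-antisym
      (≤-trans (d≤len (step (subst (0 <_) (sym (weights≡ vy vz)) (s≤s z≤n)) nil))
               (≤-reflexive (trans (+-identityʳ (w vy vz)) (weights≡ vy vz))))
      (n≢0⇒n>0 λ eq → y≢z (d-zero eq))
      where
      y≢z : _≢_ {A = Vertex n} vy vz
      y≢z ()

    triangle : ∀ k → Triangles.Triangle (induced G) (vy , vz , vx k)
    triangle k = odd-perimeter⇒triangle G (d vz (vx k)) (begin
      d vy vz + d vz (vx k) + d vy (vx k)
        ≡⟨ cong₂ (λ a b → a + d vz (vx k) + b) d-yz (d≡D vy (vx k) ¬pair-y) ⟩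
      suc (d vz (vx k) + ∣ c - skip c (toℕ k) ∣)
        ≡⟨ cong (λ a → suc (d vz (vx k) + a)) (sym (d≡D vz (vx k) ¬pair-z)) ⟩
      suc (d vz (vx k) + d vz (vx k))
        ≡⟨ cong (λ a → suc (d vz (vx k) + a)) (sym (+-identityʳ _)) ⟩
      suc (2 * d vz (vx k)) ∎)
      where
      open ≡-Reasoning
      ¬pair-y : ¬ Pair vy (vx k)
      ¬pair-y (inj₁ (_ , ()))
      ¬pair-y (inj₂ (_ , ()))
      ¬pair-z : ¬ Pair vz (vx k)
      ¬pair-z (inj₁ (_ , ()))
      ¬pair-z (inj₂ (_ , ()))

  twins-shape : Shape c (suc c) (induced G)
  twins-shape = levels⇒shape triangle

pathEdge≡ : ∀ a b → pathEdge a b ≡ 𝟙 (consecutive a b ∧ true)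
pathEdge≡ a b = cong 𝟙 (sym (∧-identityʳ (consecutive a b)))

-- At `c = 0` the weights of R become those of Q: indices start at 1, so no edge has lower end 0 to
-- be deleted, and only `x_1` touches y and z.
Q-shape : ∀ n (n≥3 : 3 ≤ n) → Shape 0 1 (𝓠 n n≥3)
Q-shape n n≥3 = Twins.twins-shape z≤n (Q n n≥3) λ where
  (vx j) (vx k) → pathEdge≡ (index j) (index k)
  (vx j) vy     → refl
  (vx j) vz     → refl
  vy     (vx k) → refl
  vz     (vx k) → refl
  vy     vy     → refl
  vy     vz     → refl
  vz     vy     → refl
  vz     vz     → refl

∈I⇒≤ : ∀ {n i} → i ∈I n → i ≤ n ∸ 2
∈I⇒≤ {n} (_ , i≤) = ≤-trans i≤ (≤-trans (⌈n/2⌉≤n (n ∸ 3)) (∸-monoʳ-≤ n (n≤1+n 2)))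

R-shape : ∀ n i n≥4 i∈I → Shape i (suc i) (𝓡 n i n≥4 i∈I)
R-shape n i n≥4 i∈I = Twins.twins-shape (∈I⇒≤ {n} i∈I) (R n i n≥4 i∈I) (λ _ _ → refl)

-- The graph S

S-shape : ∀ n (n≥3 : 3 ≤ n) → Shape 0 (suc (n ∸ 2)) (𝓢 n n≥3)
S-shape n n≥3 = levels⇒shape triangle
  where
  open Graph (S n n≥3)
  m : ℕ
  m = n ∸ 2

  0<m : 0 < m
  0<m = m<n⇒0<n∸m n≥3

  level : Vertex n → ℕ
  level (vx k) = suc (toℕ k)
  level vy     = 0
  level vz     = suc m

  level-injective : ∀ u v → level u ≡ level v → u ≡ v
  level-injective (vx j) (vx k) eq = cong vx (Finₚ.toℕ-injective (suc-injective eq))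
  level-injective (vx j) vz     eq = ⊥-elim (<⇒≢ (Finₚ.toℕ<n j) (suc-injective eq))
  level-injective vz     (vx k) eq = ⊥-elim (<⇒≢ (Finₚ.toℕ<n k) (suc-injective (sym eq)))
  level-injective vy     vy     eq = refl
  level-injective vz     vz     eq = refl

  level≤ : ∀ v → level v ≤ suc m
  level≤ (vx k) = s≤s (<⇒≤ (Finₚ.toℕ<n k))
  level≤ vy     = z≤n
  level≤ vz     = ≤-refl

  ranking : Ranking (vertexSet n)
  ranking = record
    { rank = level ; injective = level-injective _ _ ; bounded = λ v → s≤s (level≤ v) }

  onto : ∀ {k} → k ≤ suc m → ∃[ v ] level v ≡ k
  onto {zero}  _         = vy , refl
  onto {suc k} (s≤s k≤m) with m≤n⇒m<n∨m≡n k≤m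
  ... | inj₁ k<m  = vx (fromℕ< k<m) , cong suc (Finₚ.toℕ-fromℕ< k<m)
  ... | inj₂ refl = vz , refl

  𝟙-≡ᵇ : ∀ {a b} → a ≡ b → 𝟙 (a ≡ᵇ b) ≡ 1
  𝟙-≡ᵇ {a} {b} eq with a ≡ᵇ b in a≡ᵇb
  ... | true  = refl
  ... | false = ⊥-elim (subst T a≡ᵇb (≡⇒≡ᵇ a b eq))

  link : ∀ u v → level v ≡ suc (level u) → w u v ≡ 1
  link (vx j) (vx k) eq = 𝟙-≡ᵇ (trans (∣-∣-comm (toℕ j) (toℕ k))
    (trans (cong ∣_- toℕ j ∣ (suc-injective eq)) (∣1+a-a∣≡1 (toℕ j))))
  link (vx j) vz     eq = 𝟙-≡ᵇ (sym (suc-injective eq))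
  link vy     (vx k) eq = 𝟙-≡ᵇ eq
  link vy     vz     eq = ⊥-elim (<⇒≢ 0<m (sym (suc-injective eq)))
  link vz     (vx k) eq = ⊥-elim (<⇒≢ (m≤n⇒m≤1+n (Finₚ.toℕ<n k)) (suc-injective eq))
  link vz     vz     eq = ⊥-elim (1+n≢n (sym eq))

  last-gap : ∀ {a b} → suc a ≡ b → ∣ a - b ∣ ≡ 1
  last-gap {a} refl = trans (∣-∣-comm a (suc a)) (∣1+a-a∣≡1 a)

  gap≤1 : ∀ {b D} → (T b → D ≡ 1) → 0 < 𝟙 b → D ⊓ m ≤ 𝟙 b
  gap≤1 {true} {D} D≡1 _ = ≤-trans (m⊓n≤m D m) (≤-reflexive (D≡1 _))

  edge : ∀ u v → Adjacent u v → ∣ level u - level v ∣ ⊓ m ≤ w u v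
  edge (vx j) (vx k) = gap≤1 (≡ᵇ⇒≡ _ 1)
  edge (vx j) vy     = gap≤1 (≡ᵇ⇒≡ _ 1)
  edge vy     (vx k) = gap≤1 (≡ᵇ⇒≡ _ 1)
  edge (vx j) vz     = gap≤1 (last-gap ∘ ≡ᵇ⇒≡ (suc (toℕ j)) m)
  edge vz     (vx k) = gap≤1 (trans (∣-∣-comm m (toℕ k)) ∘ last-gap ∘ ≡ᵇ⇒≡ (suc (toℕ k)) m)
  -- This edge of weight `m` spans `m + 1` levels, which is why the truncation is at `m`; every
  -- other pair is at most `m` levels apart.
  edge vy     vz     = λ _ → m⊓n≤n (suc m) m
  edge vz     vy     = λ _ → m⊓n≤n (suc m) m

  D≤m : ∀ u v → ¬ Pair u v → ∣ level u - level v ∣ ≤ m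
  D≤m (vx j) (vx k) _ = ∣m-n∣≤o (<⇒≤ (Finₚ.toℕ<n j)) (<⇒≤ (Finₚ.toℕ<n k))
  D≤m (vx j) vy     _ = Finₚ.toℕ<n j
  D≤m vy     (vx k) _ = Finₚ.toℕ<n k
  D≤m (vx j) vz     _ = ∣m-n∣≤o (<⇒≤ (Finₚ.toℕ<n j)) ≤-refl
  D≤m vz     (vx k) _ = ∣m-n∣≤o ≤-refl (<⇒≤ (Finₚ.toℕ<n k))
  D≤m vy     vy     _ = z≤n
  D≤m vz     vz     _ = subst (_≤ m) (sym (∣n-n∣≡0 m)) z≤n
  D≤m vy     vz     ¬pair = ⊥-elim (¬pair (inj₁ (refl , refl)))
  D≤m vz     vy     ¬pair = ⊥-elim (¬pair (inj₂ (refl , refl)))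

  open Levels (S n n≥3) ranking level (suc m) m level≤ onto link edge
    (λ u v u≢v ¬pair → u≢v ∘ level-injective u v , D≤m u v ¬pair) (λ _ _ → <⇒≤)

  d-yz : d vy vz ≡ m
  d-yz = ≤-antisym
    (≤-trans (d≤len (step 0<m nil)) (≤-reflexive (+-identityʳ m)))
    (subst (_≤ d vy vz) (m≥n⇒m⊓n≡n (n≤1+n m)) (D⊓M≤d vy vz))

  triangle : ∀ k → Triangles.Triangle (𝓢 n n≥3) (vy , vz , vx k)
  triangle k = odd-perimeter⇒triangle (S n n≥3) m (begin
    d vy vz + d vz (vx k) + d vy (vx k)
      ≡⟨ cong₂ _+_ (cong₂ _+_ d-yz (d≡D vz (vx k) λ { (inj₁ (_ , ())) ; (inj₂ (_ , ())) }))
                   (d≡D vy (vx k) λ { (inj₁ (_ , ())) ; (inj₂ (_ , ())) }) ⟩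
    m + ∣ m - a ∣ + suc a    ≡⟨ cong (λ b → m + b + suc a)
                                  (trans (∣-∣-comm m a) (m≤n⇒∣m-n∣≡n∸m a≤m)) ⟩
    m + (m ∸ a) + suc a      ≡⟨ +-assoc m (m ∸ a) (suc a) ⟩
    m + ((m ∸ a) + suc a)    ≡⟨ cong (m +_) (+-suc (m ∸ a) a) ⟩
    m + suc ((m ∸ a) + a)    ≡⟨ cong (λ b → m + suc b) (m∸n+n≡m a≤m) ⟩
    m + suc m                ≡⟨ +-suc m m ⟩
    suc (m + m)              ≡⟨ cong (λ b → suc (m + b)) (+-identityʳ m) ⟨
    suc (2 * m)              ∎)
    where
    open ≡-Reasoning
    a : ℕ
    a = toℕ k
    a≤m : a ≤ m
    a≤m = <⇒≤ (Finₚ.toℕ<n k)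

-- Classification

size-vertexSet : ∀ {n} → 3 ≤ n → size (vertexSet n) ≡ n
size-vertexSet n≥3 = m+[n∸m]≡n (≤-trans (n≤1+n 2) n≥3)

isτ : ∀ n → 3 ≤ n → Isτ Orderable n 0 (n ∸ 2)
isτ n n≥3 =
    ( m<n⇒0<n∸m n≥3
    , vertexSet n , 𝓠 n n≥3 , size-vertexSet n≥3
    , shape-coSize (Q-shape n n≥3) 0≢1 (subst (3 ≤_) (sym (size-vertexSet n≥3)) n≥3)
    , shape⇒orderable (Q-shape n n≥3) 0≢1 )
  , λ { _ 0<m′ (V , B , refl , refl , orderable) → orderable⇒size∸2≤coSize {B = B} orderable 0<m′ }
  where
  0≢1 : 0 ≢ 1
  0≢1 ()

Isτ-unique : ∀ {Φ : Property} {n k m m′} → Isτ Φ n k m → Isτ Φ n k m′ → m ≡ m′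
Isτ-unique ((k<m , realized) , least) ((k<m′ , realized′) , least′) =
  ≤-antisym (least _ k<m′ realized′) (least′ _ k<m realized)

Listed : ∀ n → 3 ≤ n → {V : FiniteSet} → BetweennessStructure V → Set
Listed n n≥3 B =
    B ≅ 𝓠 n n≥3
  ⊎ (Σ[ n≥4 ∈ 4 ≤ n ] Σ[ i ∈ ℕ ] Σ[ i∈I ∈ i ∈I n ] B ≅ 𝓡 n i n≥4 i∈I)
  ⊎ B ≅ 𝓢 n n≥3

module _ {V : FiniteSet} {B : BetweennessStructure V} where

  shape-cast : ∀ {p p′ q q′} → p ≡ p′ → q ≡ q′ → Shape p q B → Shape p′ q′ B
  shape-cast = subst₂ (λ p q → Shape p q B)

  shape⇒minimum : ∀ {n p q} → 3 ≤ n → size V ≡ n → p ≢ q → Shape p q B →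
                  Orderable B × Isτ Orderable n 0 (coSize B)
  shape⇒minimum n≥3 refl p≢q s =
      shape⇒orderable s p≢q
    , subst (Isτ Orderable _ 0) (sym (shape-coSize s p≢q n≥3)) (isτ _ n≥3)

  module _ {n} (n≥3 : 3 ≤ n) (size≡ : size V ≡ n) where

    private
      size≡′ : size V ≡ size (vertexSet n)
      size≡′ = trans size≡ (sym (size-vertexSet n≥3))

    listed⇒minimum : Listed n n≥3 B → Orderable B × Isτ Orderable n 0 (coSize B)
    listed⇒minimum (inj₁ iso) = shape⇒minimum n≥3 size≡ (λ ())
      (shape-pullback size≡′ iso (Q-shape n n≥3))
    listed⇒minimum (inj₂ (inj₁ (n≥4 , i , i∈I , iso))) = shape⇒minimum n≥3 size≡ (1+n≢n ∘ sym)
      (shape-pullback size≡′ iso (R-shape n i n≥4 i∈I))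
    listed⇒minimum (inj₂ (inj₂ iso)) = shape⇒minimum n≥3 size≡ (λ ())
      (shape-pullback size≡′ iso (S-shape n n≥3))

  module _ k (size≡ : size V ≡ 3 + k) where

    private
      n≥3 : 3 ≤ 3 + k
      n≥3 = s≤s (s≤s (s≤s z≤n))

    near-start : ∀ {i} → 1 ≤ i → i ≤ ⌈ k /2⌉ → Shape i (suc i) B → Listed (3 + k) n≥3 B
    near-start {i} 1≤i i≤ s = inj₂ (inj₁
        (n≥4 , i , i∈I , shape⇒≅ size≡ s (R-shape (3 + k) i n≥4 i∈I)))
      where
      i∈I : i ∈I 3 + k
      i∈I = 1≤i , i≤
      -- The existence of an admissible `i` forces `k` to be positive.
      n≥4 : 4 ≤ 3 + k
      n≥4 = s≤s (s≤s (s≤s (≤-trans 1≤i (≤-trans i≤ (⌈n/2⌉≤n k)))))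

    -- Reversal sends position `c` of the pair to `k + 1 - c`, and `⌈ k /2⌉` is the largest `c` not
    -- exceeding its mirror image. Larger positions are therefore reversed first.
    consecutive⇒listed : ∀ {p} → suc p < 3 + k → Shape p (suc p) B → Listed (3 + k) n≥3 B
    consecutive⇒listed {zero}  _ s = inj₁ (shape⇒≅ size≡ s (Q-shape (3 + k) n≥3))
    consecutive⇒listed {suc p} (s≤s (s≤s (s≤s p≤k))) s =
      [ (λ le → near-start (s≤s z≤n) le s)
      , (λ gt → from-reversed (k ∸ p) (k∸p≤ gt)
          (shape-cast (cong (_∸ (3 + p)) size≡)
            (trans (cong (_∸ (2 + p)) size≡) (+-∸-assoc 1 p≤k)) (shape-reverse s)))
      ]′ (≤-<-connex (suc p) ⌈ k /2⌉)
      where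
      k∸p≤ : ⌈ k /2⌉ < suc p → k ∸ p ≤ ⌈ k /2⌉
      k∸p≤ gt = begin
        k ∸ p                        ≤⟨ ∸-monoʳ-≤ k (s≤s⁻¹ gt) ⟩
        k ∸ ⌈ k /2⌉                  ≡⟨ cong (_∸ ⌈ k /2⌉) (⌊n/2⌋+⌈n/2⌉≡n k) ⟨
        ⌊ k /2⌋ + ⌈ k /2⌉ ∸ ⌈ k /2⌉  ≡⟨ m+n∸n≡m ⌊ k /2⌋ ⌈ k /2⌉ ⟩
        ⌊ k /2⌋                      ≤⟨ ⌊n/2⌋≤⌈n/2⌉ k ⟩
        ⌈ k /2⌉                      ∎
        where open ≤-Reasoning
      from-reversed : ∀ j → j ≤ ⌈ k /2⌉ → Shape j (suc j) B → Listed (3 + k) n≥3 B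
      -- Here `Y` and `Z` were the last two points of the order, so the reversed structure is that
      -- of Q.
      from-reversed zero    _  s = inj₁ (shape⇒≅ size≡ s (Q-shape (3 + k) n≥3))
      from-reversed (suc j) j≤ s = near-start (s≤s z≤n) j≤ s

    shape⇒listed : ∀ {p q} → p < q → Shape p q B → Listed (3 + k) n≥3 B
    shape⇒listed {p} {q} p<q s = by-position (shape-position s p<q)
      where
      q<n : q < 3 + k
      q<n = subst₂ _<_ (Shape.rank-Z s) size≡ (Shape.bounded s (Shape.Z s))
      by-position : q ≡ suc p ⊎ (p ≡ 0 × suc q ≡ size V) → Listed (3 + k) n≥3 B
      by-position (inj₁ q≡p+1) =
        consecutive⇒listed (subst (_< 3 + k) q≡p+1 q<n) (shape-cast refl q≡p+1 s)
      by-position (inj₂ (p≡0 , q+1≡n)) = inj₂ (inj₂ (shape⇒≅ size≡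
        (shape-cast p≡0 (suc-injective (trans q+1≡n size≡)) s) (S-shape (3 + k) n≥3)))

    minimum⇒listed : Orderable B → Isτ Orderable (3 + k) 0 (coSize B) → Listed (3 + k) n≥3 B
    minimum⇒listed orderable τ =
      from-shape (orderable⇒shape {B = B} orderable (proj₁ (proj₁ τ)) minimal)
      where
      minimal : coSize B ≤ size V ∸ 2
      minimal = ≤-reflexive (trans (Isτ-unique {Orderable} τ (isτ (3 + k) n≥3))
                                   (cong (_∸ 2) (sym size≡)))
      from-shape : (∃₂ λ p q → p < q × Shape p q B) → Listed (3 + k) n≥3 B
      from-shape (_ , _ , p<q , s) = shape⇒listed p<q s

classification : ∀ n (n≥3 : 3 ≤ n) {V} {B : BetweennessStructure V} → size V ≡ n →
                 Orderable B × Isτ Orderable n 0 (coSize B) → Listed n n≥3 B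
classification (suc (suc (suc k))) (s≤s (s≤s (s≤s z≤n))) size≡ minimum =
  minimum⇒listed k size≡ (proj₁ minimum) (proj₂ minimum)

theorem3 : ∀ n → (n≥3 : 3 ≤ n) →
    Isτ Orderable n 0 (n ∸ 2)
    × (∀ (V : FiniteSet) (B : BetweennessStructure V) → FiniteSet.size V ≡ n →
    (Orderable B × Isτ Orderable n 0 (BetweennessStructure.coSize B))
    ⇔ (B ≅ 𝓠 n n≥3
    ⊎ (Σ[ n≥4 ∈ 4 ≤ n ] Σ[ i ∈ ℕ ] Σ[ i∈I ∈ i ∈I n ] B ≅ 𝓡 n i n≥4 i∈I)
    ⊎ B ≅ 𝓢 n n≥3))
theorem3 n n≥3 = isτ n n≥3 , λ V B size≡ →
  mk⇔ (classification n n≥3 size≡) (listed⇒minimum n≥3 size≡)
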